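{- Assume $S$ is symmetric. Then there exist polynomials $N^+(z),N^-(z)\in K[z]$ and $\widetilde N^+(u,z),\widetilde N^-(u,z)\in K[u,z]$ such that, as formal power series, $$\sum_{k\ge0}F_k^+z^k=\frac{N^+(z)}{D(z^2)},\qquad \sum_{k\ge0}F_k^-z^k=\frac{N^-(z)}{D(z^2)},$$ $$\sum_{k\ge0}\ \sum_{0\le\ell\le k/2}F^+_{k,\ell}u^\ell z^k=\frac{\widetilde N^+(u,z)}{\widetilde D(uz^2)D(z^2)},\qquad \sum_{k\ge0}\ \sum_{0\le\ell<k/2}F^-_{k,\ell}u^\ell z^k=\frac{\widetilde N^-(u,z)}{\widetilde D(uz^2)D(z^2)}.$$
   Context: Let $S$ be a finite set of integers with $a:=\max S\ge1$ and $b:=-\min S$; each $s\in S$ carries a weight $\omega_s$ in a field $K$ of characteristic $0$; set $\omega_s:=0$ for $s\notin S$. $S$ is called symmetric if $-S=S$ and $\omega_{ -s}=\omega_s$ for all $s\in S$ (so $b=a$). For $s\in\mathbb Z$ put $\beta_s:=\delta_{s,0}-\omega_s$ and $\widetilde\beta_s:=-\beta_{s+1}$. Notation: $[m,n]:=\{i\in\mathbb Z: m\le i\le n\}$, $X+c:=\{x+c:x\in X\}$; an $n$-subset is a subset of cardinality $n$; for a finite $I\subseteq\mathbb Z$ and $s\in\mathbb Z$, $\epsilon_s(I):=(-1)^{\#\{i\in I:\ i<s\}}$. $\mathbf T$ is the square matrix indexed by the $a$-subsets of $[-b,a-1]$ with $\mathbf T[I,J]:=\epsilon_s(I)\beta_s$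 if there is an integer $s$ with $I\cup\{a\}=(J+1)\cup\{s\}$, and $0$ otherwise; $\widetilde{\mathbf T}$ is the square matrix indexed by the $(a-1)$-subsets of $[-b-1,a-2]$ with $\widetilde{\mathbf T}[I,J]:=\epsilon_s(I)\widetilde\beta_s$ if there is an integer $s$ with $I\cup\{a-1\}=(J+1)\cup\{s\}$, and $0$ otherwise. $D(z):=\det(1-z\mathbf T)$ and $\widetilde D(z):=\det(1-z\widetilde{\mathbf T})$. For $k\ge0$, $A_k^+$ is the matrix with rows and columns indexed by the integers $0\le i,j\le k/2$ and entries $\omega_{j-i}+\omega_{k-j-i}$ if $j<k/2$ and $\omega_{j-i}$ if $j=k/2$; $A_k^-$ is the matrix with rows and columns indexed by the integers $0\le i,j<k/2$ and entries $\omega_{j-i}-\omega_{k-j-i}$. The determinant of an empty matrix is $1$. Put $F^\pm_0:=1$ and $F^\pm_k:=\det(1-A^\pm_{k-1})$ for $k\ge1$. For an index $\ell$ of $A^\pm_k$, $F^\pm_{k,\ell}$ is the $(\ell,0)$ cofactor of $1-A_k^\pm$, i.e. $(-1)^\ell$ times the determinant of $1-A_k^\pm$ with row $\ell$ and column $0$ deleted. -}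

module Defs where

open import Level using (Level; _⊔_)
open import Algebra.Bundles using (CommutativeRing; RawRing)
open import Algebra.Apartness.Bundles using (HeytingField)
import Algebra.Definitions
import Algebra.Definitions.RawMonoid
import Algebra.Definitions.RawSemiring
open import Data.Bool.Base using (if_then_else_)
open import Data.Fin.Base using (Fin; zero; suc; toℕ; fromℕ<; punchIn)
open import Data.Integer.Base as ℤ using (ℤ; +_; 0ℤ; 1ℤ; ∣_∣)
import Data.Integer.Properties as ℤ
open import Data.List.Base using (List; []; _∷_; _++_; map; filter; length; lookup; upTo)
open import Data.List.Membership.DecPropositional ℤ._≟_ using (_∈_; _∉_; find; lose)
open import Data.List.Relation.Binary.Subset.DecPropositional ℤ._≟_ using (_⊆_; _⊆?_)
open import Data.List.Relation.Unary.Any using (here; any?)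
open import Data.Nat.Base as ℕ using (ℕ; zero; suc; ⌊_/2⌋; ⌈_/2⌉)
import Data.Nat.Properties as ℕ
open import Data.Product.Base using (∃-syntax; _×_; _,_)
open import Data.Sum.Base using (_⊎_)
open import Relation.Binary.PropositionalEquality.Core using (refl)
open import Relation.Nullary.Decidable using (Dec; yes; no; does; map′; _×-dec_)
open import Relation.Nullary.Negation.Core using (¬_)
import Data.Fin.Properties as Fin

private
  variable
    c ℓ : Level
    n : ℕ

-- A finite set of integers is a list, considered up to having the same
-- members.

infix 4 _≋_ _≋?_

_≋_ : List ℤ → List ℤ → Set
X ≋ Y = X ⊆ Y × Y ⊆ X

_≋?_ : ∀ X Y → Dec (X ≋ Y)
X ≋? Y = (X ⊆? Y) ×-dec (Y ⊆? X)

IsMax : List ℤ → ℤ → Set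
IsMax S m = m ∈ S × (∀ {s} → s ∈ S → s ℤ.≤ m)

IsMin : List ℤ → ℤ → Set
IsMin S m = m ∈ S × (∀ {s} → s ∈ S → m ℤ.≤ s)

-- [ m , n ]; it is empty when n < m.
interval : ℤ → ℤ → List ℤ
interval m n = map (λ i → m ℤ.+ + i) (upTo ∣ 0ℤ ℤ.⊔ (1ℤ ℤ.+ n ℤ.- m) ∣)

-- On a duplicate-free list X, this lists every k-subset of X exactly
-- once, each as a duplicate-free list.
subsets : ℕ → List ℤ → List (List ℤ)
subsets zero    X       = [] ∷ []
subsets (suc k) []      = []
subsets (suc k) (x ∷ X) = map (x ∷_) (subsets k X) ++ subsets (suc k) X

-- Is there an integer s with I ∪ {t} = (J + 1) ∪ {s}?  For the t-subsets
-- I and J below, t ∉ I, so I ∪ {t} has one element more than J + 1 and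
-- such an s is unique.
shift? : ∀ t I J → Dec (∃[ s ] t ∷ I ≋ (s ∷ map ℤ.suc J))
shift? t I J = map′
  (λ any → let (s , _ , eq) = find any in s , eq)
  (λ (s , eq@(_ , ⊇)) → lose (⊇ (here refl)) eq)
  (any? (λ s → (t ∷ I) ≋? (s ∷ map ℤ.suc J)) (t ∷ I))

module Det (R : RawRing c ℓ) where
  open RawRing R
  open Algebra.Definitions.RawSemiring rawSemiring using (sum; _^_)

  Matrix : ℕ → Set c
  Matrix n = Fin n → Fin n → Carrier

  𝟙 : Matrix n
  𝟙 i j = if does (i Fin.≟ j) then 1# else 0#

  infixl 6 _∸_
  _∸_ : Matrix n → Matrix n → Matrix n
  (M ∸ N) i j = M i j + (- N i j)

  minor : Matrix (suc n) → Fin (suc n) → Fin (suc n) → Matrix n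
  minor M i j r s = M (punchIn i r) (punchIn j s)

  -- Laplace expansion along column 0.
  det : Matrix n → Carrier
  det {zero}  M = 1#
  det {suc n} M = sum λ i → (- 1#) ^ toℕ i * (M i zero * det (minor M i zero))

  -- Only the cofactors of entries in column 0 are needed.
  cofactor : Matrix n → Fin n → Carrier
  cofactor {suc n} M ℓ = (- 1#) ^ toℕ ℓ * det (minor M ℓ zero)

module _ (R : RawRing c ℓ) where
  open RawRing R

  const : Carrier → ℕ → Carrier
  const x zero    = x
  const x (suc _) = 0#

-- R[[X]], with multiplication the Cauchy product.
Series : RawRing c ℓ → RawRing c ℓ
Series R = record
  { Carrier = ℕ → Carrier
  ; _≈_     = λ f g → ∀ n → f n ≈ g n
  ; _+_     = λ f g n → f n + g n
  ; _*_     = λ f g n → sum {suc n} λ i → f (toℕ i) * g (n ℕ.∸ toℕ i)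
  ; -_      = λ f n → - f n
  ; 0#      = λ _ → 0#
  ; 1#      = const R 1#
  }
  where
  open RawRing R
  open Algebra.Definitions.RawMonoid +-rawMonoid using (sum)

module _ (R : RawRing c ℓ) where
  open RawRing R

  var : RawRing.Carrier (Series R)
  var 1 = 1#
  var _ = 0#

  -- F is the quotient N / D, where D is a unit of R.
  IsQuotient : (F N D : Carrier) → Set (c ⊔ ℓ)
  IsQuotient F N D = Invertible 1# _*_ D × F * D ≈ N
    where open Algebra.Definitions _≈_ using (Invertible)

-- A polynomial is a power series with finitely many non-zero
-- coefficients.
--
-- K[[u,z]] is (K[[u]])[[z]]: the coefficient of u^ℓ z^k in f is f k ℓ.

module PowerSeries (K : RawRing c ℓ) where
  open RawRing K

  K⟦z⟧ K⟦u,z⟧ : RawRing c ℓ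
  K⟦z⟧   = Series K
  K⟦u,z⟧ = Series (Series K)

  open RawRing K⟦z⟧   using () renaming (Carrier to K[[z]];   _*_ to infixl 7 _·₁_) public
  open RawRing K⟦u,z⟧ using () renaming (Carrier to K[[u,z]]; _*_ to infixl 7 _·₂_) public

  ι₁ : Carrier → K[[z]]
  ι₁ = const K

  z₁ : K[[z]]
  z₁ = var K

  ι₂ : Carrier → K[[u,z]]
  ι₂ x = const (Series K) (const K x)

  u₂ z₂ : K[[u,z]]
  u₂ = const (Series K) (var K)
  z₂ = var (Series K)

  IsPolynomial : K[[z]] → Set ℓ
  IsPolynomial f = ∃[ d ] (∀ k → d ℕ.≤ k → f k ≈ 0#)

  IsPolynomial₂ : K[[u,z]] → Set ℓ
  IsPolynomial₂ f = ∃[ d ] (∀ k ℓ → d ℕ.≤ k ⊎ d ℕ.≤ ℓ → f k ℓ ≈ 0#)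

-- Here a = max S and b = - min S.
module Weighted (K : RawRing c ℓ) (a b : ℤ) (ω : ℤ → RawRing.Carrier K) where
  open RawRing K
  open Det K
  open Algebra.Definitions.RawSemiring rawSemiring using (_^_)

  ε : ℤ → List ℤ → Carrier
  ε s I = (- 1#) ^ length (filter (ℤ._<? s) I)

  β : ℤ → Carrier
  β s = (if does (s ℤ.≟ 0ℤ) then 1# else 0#) + (- ω s)

  β̃ : ℤ → Carrier
  β̃ s = - β (s ℤ.+ 1ℤ)

  -- T and T̃ are both of the following form: rows and columns are indexed
  -- by the t-subsets of [ m , t - 1 ], and the entries come from γ.
  module Transfer (m t : ℤ) (γ : ℤ → Carrier) where

    index : List (List ℤ)
    index = subsets ∣ t ∣ (interval m (t ℤ.- 1ℤ))

    entry : List ℤ → List ℤ → Carrier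
    entry I J with shift? t I J
    ... | yes (s , _) = ε s I * γ s
    ... | no  _       = 0#

    matrix : Matrix (length index)
    matrix i j = entry (lookup index i) (lookup index j)

  module T = Transfer (ℤ.- b)         a          β
  module T̃ = Transfer (ℤ.- b ℤ.- 1ℤ) (a ℤ.- 1ℤ) β̃

  -- D and D̃ evaluated at an element x of a ring R ⊇ K, with inclusion
  -- ι : K → R.  For instance, D (z²) is det (1 - z² T).
  module _ (R : RawRing c ℓ) (ι : Carrier → RawRing.Carrier R) where
    private
      module R where
        open RawRing R public
        open Det R public

    det[1-_·_] : R.Carrier → Matrix n → R.Carrier
    det[1- x · M ] = R.det (R.𝟙 R.∸ λ i j → x R.* ι (M i j))

    D D̃ : R.Carrier → R.Carrier
    D x = det[1- x · T.matrix ]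
    D̃ x = det[1- x · T̃.matrix ]

  ω[_-_] : ℕ → ℕ → Carrier
  ω[ m - n ] = ω (+ m ℤ.- + n)

  A⁺ : ∀ k → Matrix (suc ⌊ k /2⌋)
  A⁺ k i′ j′ = if does (2 ℕ.* j ℕ.<? k) then ω[ j - i ] + ω[ k - j ℕ.+ i ] else ω[ j - i ]
    where
    i = toℕ i′
    j = toℕ j′

  A⁻ : ∀ k → Matrix ⌈ k /2⌉
  A⁻ k i′ j′ = ω[ j - i ] + (- ω[ k - j ℕ.+ i ])
    where
    i = toℕ i′
    j = toℕ j′

  F⁺ F⁻ : ℕ → Carrier
  F⁺ zero    = 1#
  F⁺ (suc k) = det (𝟙 ∸ A⁺ k)
  F⁻ zero    = 1#
  F⁻ (suc k) = det (𝟙 ∸ A⁻ k)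

  -- ℓ ↦ F_{k,ℓ}, extended by 0 to those ℓ that are not an index of A k.
  F⁺₂ F⁻₂ : ℕ → ℕ → Carrier
  F⁺₂ k ℓ with ℓ ℕ.<? suc ⌊ k /2⌋
  ... | yes ℓ< = cofactor (𝟙 ∸ A⁺ k) (fromℕ< ℓ<)
  ... | no  _  = 0#
  F⁻₂ k ℓ with ℓ ℕ.<? ⌈ k /2⌉
  ... | yes ℓ< = cofactor (𝟙 ∸ A⁻ k) (fromℕ< ℓ<)
  ... | no  _  = 0#

module _ {c ℓ₁ ℓ₂} (K : HeytingField c ℓ₁ ℓ₂) where
  open HeytingField K

  commutativeRing : CommutativeRing c ℓ₁
  commutativeRing = record { isCommutativeRing = isCommutativeRing }

  rawRing : RawRing c ℓ₁
  rawRing = CommutativeRing.rawRing commutativeRing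

  open Algebra.Definitions.RawMonoid (RawRing.+-rawMonoid rawRing) using () renaming (_×_ to _·_)

  CharacteristicZero : Set ℓ₁
  CharacteristicZero = ∀ n → ¬ (suc n · 1# ≈ 0#)

  IsSymmetric : List ℤ → (ℤ → Carrier) → Set ℓ₁
  IsSymmetric S ω = map ℤ.-_ S ≋ S × (∀ {s} → s ∈ S → ω (ℤ.- s) ≈ ω s)

{-# OPTIONS --safe #-}
module Submission where

-- Expanding a banded determinant along its first row chooses, from the
-- unused columns, one column s of the band, and leaves a determinant of
-- the same shape with one row less.  The a unused columns of the band form
-- the state I, and the sum over s is multiplication by T.  So, apart from
-- the rows near the corner where the Hankel part of A_k lives, the
-- determinants f I k with the columns I, a, a + 1, … satisfy
-- f I (k + 2) = Σ T[I,J] f J k, and (1 - z² T) Φ is polynomial for the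
-- vector Φ of their generating functions.  By Cramer's rule D(z²) Φ is
-- polynomial.  Deleting column 0 leaves a - 1 unused columns of the band,
-- and the rows above the deleted row ℓ are processed by T̃, those below by
-- T; hence D(z²) (1 - u z² T̃) Γ is polynomial for the cofactors.
--
-- Symmetry is only used in the form b = a.

open import Defs
open import Algebra.Apartness.Bundles using (HeytingField)
open import Data.Integer.Base as ℤ using (ℤ; 1ℤ)
open import Data.List.Base using (List)
open import Data.List.Membership.Propositional using (_∉_)
open import Data.Product.Base using (∃-syntax; _×_)

open import Level using (Level; _⊔_; 0ℓ) renaming (suc to lsuc)
open import Algebra.Bundles using (CommutativeRing; RawRing; Semiring)
import Algebra.Definitions
import Algebra.Definitions.RawSemiring
import Algebra.Properties.Ring
import Algebra.Properties.Semiring.Sum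
import Algebra.Solver.CommutativeMonoid
open import Data.Bool.Base using (true; false; if_then_else_)
open import Data.Fin.Base using (Fin; zero; suc; toℕ; fromℕ<; inject₁; punchIn)
open import Data.Fin.Induction using (<-weakInduction)
import Data.Fin.Properties as Fin
open import Data.Integer.Base using (+_; 0ℤ; ∣_∣)
import Data.Integer.Properties as ℤ
open import Data.Integer.Solver using (module +-*-Solver)
open import Data.List.Base using ([]; _∷_; _++_; _∷ʳ_; map; filter; length; lookup)
open import Data.List.Membership.Propositional using (_∈_; find; lose)
open import Data.List.Membership.Propositional.Properties
  using (∈-map⁺; ∈-map⁻; ∈-++⁺ˡ; ∈-++⁺ʳ; ∈-++⁻; ∈-upTo⁺; ∈-upTo⁻; ∈-lookup)
import Data.List.Properties as List
open import Data.List.Relation.Binary.Subset.Propositional using (_⊆_)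
open import Data.List.Relation.Unary.All as All using (All; []; _∷_)
import Data.List.Relation.Unary.All.Properties as All
open import Data.List.Relation.Unary.AllPairs as AllPairs using (AllPairs; []; _∷_)
import Data.List.Relation.Unary.AllPairs.Properties as AllPairs
open import Data.List.Relation.Unary.Any as Any using (Any; here; there; any?)
open import Data.List.Relation.Unary.Any.Properties using (lookup-index)
open import Data.List.Relation.Unary.Unique.Propositional using (Unique)
import Data.List.Relation.Unary.Unique.Propositional.Properties as Unique
open import Data.Nat.Base as ℕ using (ℕ; zero; suc; z≤n; s≤s; ⌊_/2⌋; ⌈_/2⌉)
import Data.Nat.Properties as ℕ
open import Data.Product.Base using (_,_; proj₁; proj₂)
open import Data.Sum.Base using (inj₁; inj₂)
open import Data.Unit.Base using (⊤; tt)
open import Function.Bundles using (mk⇔)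
import Relation.Binary.Reasoning.Setoid
open import Relation.Binary.PropositionalEquality as ≡ using (_≡_; _≢_)
open import Relation.Nullary.Decidable using (Dec; yes; no; does; dec-true; dec-false; does-⇔)
open import Relation.Nullary.Negation.Core using (contradiction)

-- The matrix is treated as if it had a column for every integer, so that a state may reach left of
-- column 0. A step lowers the remaining columns by 1 and can take one of them below -a, outside the
-- index set of `T`. That determinant is 0: such a column lies left of the band and, as b = a, also
-- out of reach of the Hankel part. So restricting the sum to the index set loses nothing.
--
-- Row 0 is free of Hankel entries, and all a columns of a state are present, once k ≥ 2a. The
-- finitely many earlier coefficients can violate the recurrence only by a polynomial.
--
-- For the cofactors, the case ℓ = 0 is a boundary case: no row is left above the deleted one, and
-- what remains is `f` at the state I ∪ {a - 1}. This is an inhomogeneous term with denominator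
-- D(z²), so D(z²) has to be multiplied in before Cramer's rule is applied to 1 - u z² T̃.
--
-- No numerator is computed. It is the series times the denominator, and its polynomiality is
-- membership in a subring, which determinants and Cramer's rule respect.

private
  variable
    c ℓ ℓ′ : Level
    n : ℕ

-- Determinants

-- The transposition of p and p + 1. Adjacent transpositions suit the expansion along column 0: for
-- p ≥ 1 they leave that column in place and pass to the minors.
swap : Fin n → Fin (suc n) → Fin (suc n)
swap zero    zero          = suc zero
swap zero    (suc zero)    = zero
swap zero    (suc (suc j)) = suc (suc j)
swap (suc p) zero          = zero
swap (suc p) (suc j)       = suc (swap p j)

swap-inject₁ : (p : Fin n) → swap p (inject₁ p) ≡ suc p
swap-inject₁ zero    = ≡.refl
swap-inject₁ (suc p) = ≡.cong suc (swap-inject₁ p)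

-- CommutativeRing.rawRing itself would make the comparison of types that
-- mention Weighted very slow.
raw : CommutativeRing c ℓ → RawRing c ℓ
raw R = CommutativeRing.rawRing R

-- The rings in question consist of power series and the subrings of polynomials. Closure under the
-- ring operations, and hence under determinants, replaces any degree computation for the
-- numerators.
record Subring (R : CommutativeRing c ℓ) (ℓ′ : Level) : Set (c ⊔ ℓ ⊔ lsuc ℓ′) where
  open CommutativeRing R
  field
    Member  : Carrier → Set ℓ′
    resp    : ∀ {x y} → x ≈ y → Member x → Member y
    0∈      : Member 0#
    1∈      : Member 1#
    +-∈     : ∀ {x y} → Member x → Member y → Member (x + y)
    *-∈     : ∀ {x y} → Member x → Member y → Member (x * y)
    -‿∈     : ∀ {x} → Member x → Member (- x)

module Determinant (R : CommutativeRing c ℓ) where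
  open CommutativeRing R hiding (rawRing; zero)
  open Det (raw R) public
  open Algebra.Properties.Semiring.Sum semiring public
  open Algebra.Properties.Ring ring
  open Algebra.Definitions.RawSemiring (Semiring.rawSemiring semiring) using (_^_) public
  module *-Solver = Algebra.Solver.CommutativeMonoid *-commutativeMonoid
  open Relation.Binary.Reasoning.Setoid setoid

  sgn : ℕ → Carrier
  sgn k = (- 1#) ^ k

  sum-zero : {f : Fin n → Carrier} → (∀ i → f i ≈ 0#) → sum f ≈ 0#
  sum-zero {n} f≈0 = trans (sum-cong-≋ f≈0) (sum-replicate-zero n)

  sum-single : ∀ {n} {f : Fin n → Carrier} (k : Fin n) → (∀ i → i ≢ k → f i ≈ 0#) → sum f ≈ f k
  sum-single {suc n} {f} k f≈0 = trans (sum-remove {i = k} f)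
    (trans (+-congˡ (sum-zero λ i → f≈0 (punchIn k i) (Fin.punchInᵢ≢i k i))) (+-identityʳ (f k)))

  sum-𝟙 : (i : Fin n) (x : Fin n → Carrier) → sum (λ j → 𝟙 i j * x j) ≈ x i
  sum-𝟙 i x = trans
    (sum-single i λ j j≢i → trans (*-congʳ {x j} (reflexive (≡.cong (λ b → if b then 1# else 0#)
      (dec-false (i Fin.≟ j) λ i≡j → j≢i (≡.sym i≡j))))) (zeroˡ _))
    (trans (*-congʳ {x i} (reflexive (≡.cong (λ b → if b then 1# else 0#) (dec-true (i Fin.≟ i) ≡.refl))))
      (*-identityˡ _))

  sum-neg : (f : Fin n → Carrier) → sum (λ i → - f i) ≈ - sum f
  sum-neg f = begin
    sum (λ i → - f i)       ≈⟨ sum-cong-≋ (λ i → sym (-1*x≈-x (f i))) ⟩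
    sum (λ i → - 1# * f i)  ≈⟨ *-distribˡ-sum (- 1#) f ⟨
    - 1# * sum f            ≈⟨ -1*x≈-x _ ⟩
    - sum f                 ∎

  sum-swap : (p : Fin n) (f : Fin (suc n) → Carrier) → sum (λ j → f (swap p j)) ≈ sum f
  sum-swap {suc n} zero f = begin
    f (suc zero) + (f zero + rest)  ≈⟨ +-assoc _ _ _ ⟨
    f (suc zero) + f zero + rest    ≈⟨ +-congʳ (+-comm _ _) ⟩
    f zero + f (suc zero) + rest    ≈⟨ +-assoc _ _ _ ⟩
    f zero + (f (suc zero) + rest)  ∎
    where rest = sum (λ j → f (suc (suc j)))
  sum-swap (suc p) f = +-congˡ (sum-swap p (λ j → f (suc j)))

  x[yz]≈0 : ∀ x y {z} → z ≈ 0# → x * (y * z) ≈ 0#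
  x[yz]≈0 x y z≈0 = trans (*-congˡ (trans (*-congˡ z≈0) (zeroʳ y))) (zeroʳ x)

  det-cong : {M N : Matrix n} → (∀ i j → M i j ≈ N i j) → det M ≈ det N
  det-cong {zero}  M≈N = refl
  det-cong {suc n} M≈N = sum-cong-≋ λ i →
    *-congˡ {sgn (toℕ i)} (*-cong (M≈N i zero) (det-cong λ r s → M≈N (punchIn i r) (suc s)))

  -- `det` expands along column 0, while a step of the recurrence removes row 0. The corner term is
  -- common to both expansions. Every other minor still contains row 0, is expanded along it by
  -- induction, and exchanging the two sums leaves the column expansions of the minors without row
  -- 0.
  det-expandRow : (M : Matrix (suc n)) →
    det M ≈ sum λ j → sgn (toℕ j) * (M zero j * det (minor M zero j))
  det-expandRow {zero}  M = refl
  det-expandRow {suc n} M = +-congˡ (begin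
    (sum λ i → sgn (suc (toℕ i)) * (M (suc i) zero * det (minor M (suc i) zero)))
      ≈⟨ sum-cong-≋ (λ i → trans (*-congˡ (*-congˡ (det-expandRow (minor M (suc i) zero))))
           (pull (sgn (suc (toℕ i))) (M (suc i) zero) λ j → sgn (toℕ j) * (M zero (suc j) * d i j))) ⟩
    (sum λ i → sum λ j → sgn (suc (toℕ i)) * (M (suc i) zero * (sgn (toℕ j) * (M zero (suc j) * d i j))))
      ≈⟨ ∑-comm (λ i j → sgn (suc (toℕ i)) * (M (suc i) zero * (sgn (toℕ j) * (M zero (suc j) * d i j)))) ⟩
    (sum λ j → sum λ i → sgn (suc (toℕ i)) * (M (suc i) zero * (sgn (toℕ j) * (M zero (suc j) * d i j))))
      ≈⟨ sum-cong-≋ (λ j → sum-cong-≋ λ i →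
           exchange (- 1#) (sgn (toℕ i)) (M (suc i) zero) (sgn (toℕ j)) (M zero (suc j)) (d i j)) ⟩
    (sum λ j → sum λ i → sgn (suc (toℕ j)) * (M zero (suc j) * (sgn (toℕ i) * (M (suc i) zero * d i j))))
      ≈⟨ sum-cong-≋ (λ j → sym (pull (sgn (suc (toℕ j))) (M zero (suc j))
           λ i → sgn (toℕ i) * (M (suc i) zero * d i j))) ⟩
    (sum λ j → sgn (suc (toℕ j)) * (M zero (suc j) * det (minor M zero (suc j)))) ∎)
    where
    d : Fin (suc n) → Fin (suc n) → Carrier
    d i j = det (λ r s → M (suc (punchIn i r)) (suc (punchIn j s)))

    pull : ∀ {k} x y (f : Fin k → Carrier) → x * (y * sum f) ≈ sum (λ i → x * (y * f i))
    pull x y f = trans (*-congˡ (*-distribˡ-sum y f)) (*-distribˡ-sum x (λ i → y * f i))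

    exchange : ∀ m s x t y d → (m * s) * (x * (t * (y * d))) ≈ (m * t) * (y * (s * (x * d)))
    exchange = *-Solver.solve 6 (λ m s x t y d →
      ((m ⊕ s) ⊕ (x ⊕ (t ⊕ (y ⊕ d)))) ⊜ ((m ⊕ t) ⊕ (y ⊕ (s ⊕ (x ⊕ d))))) refl
      where open *-Solver using (_⊕_; _⊜_)

  det-zeroColumn : {M : Matrix n} (j : Fin n) → (∀ i → M i j ≈ 0#) → det M ≈ 0#
  det-zeroColumn {M = M} zero M≈0 = sum-zero λ i →
    trans (*-congˡ {sgn (toℕ i)} (trans (*-congʳ {det (minor M i zero)} (M≈0 i)) (zeroˡ _))) (zeroʳ _)
  det-zeroColumn {suc (suc n)} {M} (suc j) M≈0 = sum-zero λ i →
    x[yz]≈0 (sgn (toℕ i)) (M i zero) (det-zeroColumn {M = minor M i zero} j (λ r → M≈0 (punchIn i r)))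

  det-𝟙 : ∀ n → det (𝟙 {n}) ≈ 1#
  det-𝟙 zero    = refl
  det-𝟙 (suc n) = begin
    1# * (1# * det (𝟙 {n})) + rest  ≈⟨ +-cong (trans (*-identityˡ _) (trans (*-identityˡ _) (det-𝟙 n)))
                                        (sum-zero rest≈0) ⟩
    1# + 0#                         ≈⟨ +-identityʳ 1# ⟩
    1#                              ∎
    where
    term : Fin n → Carrier
    term i = sgn (suc (toℕ i)) * (0# * det (minor 𝟙 (suc i) zero))
    rest = sum term
    rest≈0 : ∀ i → term i ≈ 0#
    rest≈0 i = trans (*-congˡ (zeroˡ _)) (zeroʳ _)

  punchIn-swap : ∀ {n} (j : Fin (suc n)) s →
    swap zero (punchIn (suc (suc j)) s) ≡ punchIn (suc (suc j)) (swap zero s)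
  punchIn-swap j zero          = ≡.refl
  punchIn-swap j (suc zero)    = ≡.refl
  punchIn-swap j (suc (suc s)) = ≡.refl

  -- Columns 0 and 1 cannot be swapped inside the expansion along column 0, so that case expands
  -- along row 0: the first two terms trade places with opposite signs, and each remaining minor
  -- contains both columns.
  det-swap : (p : Fin n) (M : Matrix (suc n)) → det (λ i j → M i (swap p j)) ≈ - det M
  det-swap {suc n} zero M = begin
    det M′
      ≈⟨ det-expandRow M′ ⟩
    1# * (M zero (suc zero) * det (minor M′ zero zero)) +
      ((- 1# * 1#) * (M zero zero * det (minor M′ zero (suc zero))) + rest M′)
      ≈⟨ +-cong (*-congˡ (*-congˡ (det-cong minor₀)))
           (+-cong (*-congˡ (*-congˡ (det-cong minor₁))) (sum-cong-≋ minor₂)) ⟩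
    1# * x₁ + ((- 1# * 1#) * x₀ + sum (λ j → - term j))
      ≈⟨ +-cong (1*x≈--1*x x₁) (+-cong (trans (*-congʳ (*-identityʳ _)) (-1*x≈-x x₀)) (sum-neg term)) ⟩
    - ((- 1# * 1#) * x₁) + (- x₀ + - rest M)
      ≈⟨ +-assoc _ _ _ ⟨
    - ((- 1# * 1#) * x₁) + - x₀ + - rest M
      ≈⟨ +-congʳ (trans (+-comm _ _) (+-congʳ (-‿cong (sym (*-identityˡ x₀))))) ⟩
    - (1# * x₀) + - ((- 1# * 1#) * x₁) + - rest M
      ≈⟨ +-assoc _ _ _ ⟩
    - (1# * x₀) + (- ((- 1# * 1#) * x₁) + - rest M)
      ≈⟨ +-congˡ (-‿+-comm _ _) ⟩
    - (1# * x₀) + - ((- 1# * 1#) * x₁ + rest M)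
      ≈⟨ -‿+-comm _ _ ⟩
    - (1# * x₀ + ((- 1# * 1#) * x₁ + rest M))
      ≈⟨ -‿cong (det-expandRow M) ⟨
    - det M ∎
    where
    M′ : Matrix (suc (suc n))
    M′ i j = M i (swap zero j)
    rest : Matrix (suc (suc n)) → Carrier
    rest N = sum λ (j : Fin n) → sgn (2 ℕ.+ toℕ j) * (N zero (suc (suc j)) * det (minor N zero (suc (suc j))))
    term : Fin n → Carrier
    term j = sgn (2 ℕ.+ toℕ j) * (M zero (suc (suc j)) * det (minor M zero (suc (suc j))))
    x₀ = M zero zero * det (minor M zero zero)
    x₁ = M zero (suc zero) * det (minor M zero (suc zero))
    1*x≈--1*x : ∀ x → 1# * x ≈ - ((- 1# * 1#) * x)
    1*x≈--1*x x = trans (*-identityˡ x) (sym (trans (-‿cong (trans (*-congʳ (*-identityʳ _)) (-1*x≈-x x))) (-‿involutive x)))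
    minor₀ : ∀ r s → minor M′ zero zero r s ≈ minor M zero (suc zero) r s
    minor₀ r zero    = refl
    minor₀ r (suc s) = refl
    minor₁ : ∀ r s → minor M′ zero (suc zero) r s ≈ minor M zero zero r s
    minor₁ r zero    = refl
    minor₁ r (suc s) = refl
    minus : ∀ {n} (M : Matrix (suc (suc n))) (j : Fin n) →
      det (minor (λ r s → M r (swap zero s)) zero (suc (suc j))) ≈ - det (minor M zero (suc (suc j)))
    minus {suc n} M j = trans (det-cong λ r s → reflexive (≡.cong (M (suc r)) (punchIn-swap j s)))
      (det-swap zero (minor M zero (suc (suc j))))
    minor₂ : ∀ j → sgn (2 ℕ.+ toℕ j) * (M zero (suc (suc j)) * det (minor M′ zero (suc (suc j)))) ≈ - term j
    minor₂ j = begin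
      sgn (2 ℕ.+ toℕ j) * (M zero (suc (suc j)) * det (minor M′ zero (suc (suc j))))
        ≈⟨ *-congˡ (*-congˡ (minus M j)) ⟩
      sgn (2 ℕ.+ toℕ j) * (M zero (suc (suc j)) * - det (minor M zero (suc (suc j))))
        ≈⟨ *-congˡ (sym (-‿distribʳ-* _ _)) ⟩
      sgn (2 ℕ.+ toℕ j) * - (M zero (suc (suc j)) * det (minor M zero (suc (suc j))))
        ≈⟨ -‿distribʳ-* _ _ ⟨
      - term j ∎
  det-swap {suc n} (suc p) M = begin
    (sum λ i → sgn (toℕ i) * (M i zero * det (λ r s → minor M i zero r (swap p s))))
      ≈⟨ sum-cong-≋ (λ i → trans
           (*-congˡ {sgn (toℕ i)} (trans (*-congˡ {M i zero} (det-swap p (minor M i zero))) (sym (-‿distribʳ-* _ _))))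
           (sym (-‿distribʳ-* _ _))) ⟩
    (sum λ i → - (sgn (toℕ i) * (M i zero * det (minor M i zero))))
      ≈⟨ sum-neg (λ i → sgn (toℕ i) * (M i zero * det (minor M i zero))) ⟩
    - det M ∎

  -- This does not follow from det-swap, because 2 may be a zero divisor.
  det-equalColumns₀₁ : (M : Matrix (suc (suc n))) → (∀ i → M i zero ≈ M i (suc zero)) → det M ≈ 0#
  det-equalColumns₀₁ {n} M eq = begin
    det M
      ≈⟨ det-expandRow M ⟩
    1# * x₀ + ((- 1# * 1#) * (M zero (suc zero) * det (minor M zero (suc zero))) + rest)
      ≈⟨ +-cong (*-identityˡ x₀) (+-cong (trans (*-congʳ (*-identityʳ _)) (trans (-1*x≈-x _) (-‿cong x₁≈x₀))) (sum-zero vanish)) ⟩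
    x₀ + (- x₀ + 0#)
      ≈⟨ trans (+-congˡ (+-identityʳ _)) (-‿inverseʳ x₀) ⟩
    0# ∎
    where
    x₀ = M zero zero * det (minor M zero zero)
    rest = sum λ (j : Fin n) → sgn (2 ℕ.+ toℕ j) * (M zero (suc (suc j)) * det (minor M zero (suc (suc j))))
    minor₁ : ∀ r s → minor M zero (suc zero) r s ≈ minor M zero zero r s
    minor₁ r zero    = eq (suc r)
    minor₁ r (suc s) = refl
    x₁≈x₀ = *-cong (sym (eq zero)) (det-cong minor₁)
    vanish′ : ∀ n (M : Matrix (suc (suc n))) → (∀ i → M i zero ≈ M i (suc zero)) →
      (j : Fin n) → det (minor M zero (suc (suc j))) ≈ 0#
    vanish′ (suc n) M eq j = det-equalColumns₀₁ (minor M zero (suc (suc j))) (λ i → eq (suc i))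
    vanish : (j : Fin n) → sgn (2 ℕ.+ toℕ j) * (M zero (suc (suc j)) * det (minor M zero (suc (suc j)))) ≈ 0#
    vanish j = x[yz]≈0 (sgn (2 ℕ.+ toℕ j)) (M zero (suc (suc j))) (vanish′ n M eq j)

  -- Adjacent swaps move the second of the equal columns left to position 1; column 0 stays fixed.
  det-equalColumns₀ : (q : Fin n) (M : Matrix (suc n)) → (∀ i → M i zero ≈ M i (suc q)) → det M ≈ 0#
  det-equalColumns₀ {suc n} = <-weakInduction
    (λ q → (M : Matrix (suc (suc n))) → (∀ i → M i zero ≈ M i (suc q)) → det M ≈ 0#)
    det-equalColumns₀₁ step
    where
    step : (q : Fin n) →
      ((M : Matrix (suc (suc n))) → (∀ i → M i zero ≈ M i (suc (inject₁ q))) → det M ≈ 0#) →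
      (M : Matrix (suc (suc n))) → (∀ i → M i zero ≈ M i (suc (suc q))) → det M ≈ 0#
    step q ih M eq = begin
      det M                                 ≈⟨ -‿involutive (det M) ⟨
      - - det M                             ≈⟨ -‿cong (det-swap (suc q) M) ⟨
      - det (λ i j → M i (swap (suc q) j))  ≈⟨ -‿cong (ih (λ i j → M i (swap (suc q) j)) λ i → trans (eq i)
                                                 (reflexive (≡.cong (λ j → M i (suc j)) (≡.sym (swap-inject₁ q))))) ⟩
      - 0#                                  ≈⟨ -0#≈0# ⟩
      0#                                    ∎

  -- The combination of the equations with the cofactors of column 0: the coefficient of x_j is the
  -- determinant with column 0 replaced by column j, which has two equal columns unless j = 0.
  det-cramer₀ : (M : Matrix (suc n)) (x : Fin (suc n) → Carrier) →
    sum (λ i → cofactor M i * sum λ j → M i j * x j) ≈ det M * x zero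
  det-cramer₀ {n} M x = begin
    (sum λ i → cofactor M i * sum λ j → M i j * x j)
      ≈⟨ sum-cong-≋ (λ i → *-distribˡ-sum (cofactor M i) (λ j → M i j * x j)) ⟩
    (sum λ i → sum λ j → cofactor M i * (M i j * x j))
      ≈⟨ ∑-comm (λ i j → cofactor M i * (M i j * x j)) ⟩
    (sum λ j → sum λ i → cofactor M i * (M i j * x j))
      ≈⟨ sum-cong-≋ (λ j → trans (sum-cong-≋ λ i → shuffle (sgn (toℕ i)) (det (minor M i zero)) (M i j) (x j))
           (sym (*-distribʳ-sum (x j) (λ i → sgn (toℕ i) * (M i j * det (minor M i zero)))))) ⟩
    det M * x zero + (sum λ j → det (replace (suc j)) * x (suc j))
      ≈⟨ +-congˡ (sum-zero λ j → trans (*-congʳ {x (suc j)} (det-equalColumns₀ j (replace (suc j)) λ _ → refl)) (zeroˡ _)) ⟩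
    det M * x zero + 0#
      ≈⟨ +-identityʳ _ ⟩
    det M * x zero ∎
    where
    replace : Fin (suc n) → Matrix (suc n)
    replace j i zero    = M i j
    replace j i (suc s) = M i (suc s)
    shuffle : ∀ s d m x → (s * d) * (m * x) ≈ (s * (m * d)) * x
    shuffle = *-Solver.solve 4 (λ s d m x → ((s ⊕ d) ⊕ (m ⊕ x)) ⊜ ((s ⊕ (m ⊕ d)) ⊕ x)) refl
      where open *-Solver using (_⊕_; _⊜_)

  -- Determinants and linear systems over a subring

  module _ (P : Subring R ℓ′) where
    open Subring P

    sum-∈ : ∀ {n} {f : Fin n → Carrier} → (∀ i → Member (f i)) → Member (sum f)
    sum-∈ {zero}  f∈ = 0∈
    sum-∈ {suc n} f∈ = +-∈ (f∈ zero) (sum-∈ (λ i → f∈ (suc i)))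

    sgn-∈ : ∀ k → Member (sgn k)
    sgn-∈ zero    = 1∈
    sgn-∈ (suc k) = *-∈ (-‿∈ 1∈) (sgn-∈ k)

    det-∈ : ∀ {n} {M : Matrix n} → (∀ i j → Member (M i j)) → Member (det M)
    det-∈ {zero}  M∈ = 1∈
    det-∈ {suc n} M∈ = sum-∈ λ i → *-∈ (sgn-∈ (toℕ i)) (*-∈ (M∈ i zero) (det-∈ λ r s → M∈ (punchIn i r) (suc s)))

    𝟙-∈ : ∀ {n} (i j : Fin n) → Member (𝟙 i j)
    𝟙-∈ i j with does (i Fin.≟ j)
    ... | true  = 1∈
    ... | false = 0∈

    -- The unknown with index k is moved to index 0 by adjacent swaps of
    -- the columns.
    cramer-∈ : ∀ {n} (M : Matrix n) (x : Fin n → Carrier) → (∀ i j → Member (M i j)) →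
      (∀ i → Member (sum λ j → M i j * x j)) → ∀ k → Member (det M * x k)
    cramer-∈ {suc n} M x M∈ Mx∈ k = <-weakInduction Cramer base step k M x M∈ Mx∈
      where
      Cramer : Fin (suc n) → Set _
      Cramer k = (M : Matrix (suc n)) (x : Fin (suc n) → Carrier) → (∀ i j → Member (M i j)) →
        (∀ i → Member (sum λ j → M i j * x j)) → Member (det M * x k)
      base : Cramer zero
      base M x M∈ Mx∈ = resp (det-cramer₀ M x) (sum-∈ λ i →
        *-∈ (*-∈ (sgn-∈ (toℕ i)) (det-∈ λ r s → M∈ (punchIn i r) (suc s))) (Mx∈ i))
      step : (k : Fin n) → Cramer (inject₁ k) → Cramer (suc k)
      step k ih M x M∈ Mx∈ = resp
        (begin
          - (det M′ * x (swap k (inject₁ k)))  ≈⟨ -‿distribˡ-* _ _ ⟩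
          - det M′ * x (swap k (inject₁ k))    ≈⟨ *-cong (trans (-‿cong (det-swap k M)) (-‿involutive (det M)))
                                                   (reflexive (≡.cong x (swap-inject₁ k))) ⟩
          det M * x (suc k)                    ∎)
        (-‿∈ (ih M′ (λ j → x (swap k j)) (λ i j → M∈ i (swap k j))
          λ i → resp (sym (sum-swap k (λ j → M i j * x j))) (Mx∈ i)))
        where
        M′ : Matrix (suc n)
        M′ i j = M i (swap k j)

    det[𝟙∸]-∈ : ∀ {n} (t : Matrix n) {x} → (∀ i j → Member (t i j)) → Member x →
      Member (det (𝟙 ∸ λ i j → x * t i j))
    det[𝟙∸]-∈ t t∈ x∈ = det-∈ λ i j → +-∈ (𝟙-∈ i j) (-‿∈ (*-∈ x∈ (t∈ i j)))

    -- The factor `y` is a denominator of the right-hand side (1 - x t) Φ. It is 1 for the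
    -- determinants `f`, and D(z²) for the cofactors, whose right-hand side is itself a rational
    -- function.
    det-clear : ∀ {n} (t : Matrix n) x y (Φ : Fin n → Carrier) → (∀ i j → Member (t i j)) → Member x →
      (∀ i → Member (y * (Φ i + - (x * sum λ j → t i j * Φ j)))) →
      ∀ i → Member (det (𝟙 ∸ λ i j → x * t i j) * (y * Φ i))
    det-clear t x y Φ t∈ x∈ r∈ = cramer-∈ (𝟙 ∸ λ i j → x * t i j) (λ j → y * Φ j)
      (λ i j → +-∈ (𝟙-∈ i j) (-‿∈ (*-∈ x∈ (t∈ i j))))
      (λ i → resp (sym (row i)) (r∈ i))
      where
      shuffle : ∀ x t y φ → x * t * (y * φ) ≈ (y * x) * (t * φ)
      shuffle = *-Solver.solve 4 (λ x t y φ → ((x ⊕ t) ⊕ (y ⊕ φ)) ⊜ ((y ⊕ x) ⊕ (t ⊕ φ))) refl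
        where open *-Solver using (_⊕_; _⊜_)
      row : ∀ i → sum (λ j → (𝟙 i j + - (x * t i j)) * (y * Φ j)) ≈ y * (Φ i + - (x * sum λ j → t i j * Φ j))
      row i = begin
        sum (λ j → (𝟙 i j + - (x * t i j)) * (y * Φ j))
          ≈⟨ sum-cong-≋ (λ j → trans (distribʳ (y * Φ j) (𝟙 i j) (- (x * t i j)))
               (+-congˡ {𝟙 i j * (y * Φ j)} (trans (sym (-‿distribˡ-* _ _)) (-‿cong (shuffle x (t i j) y (Φ j)))))) ⟩
        sum (λ j → 𝟙 i j * (y * Φ j) + - ((y * x) * (t i j * Φ j)))
          ≈⟨ ∑-distrib-+ (λ j → 𝟙 i j * (y * Φ j)) (λ j → - ((y * x) * (t i j * Φ j))) ⟩
        sum (λ j → 𝟙 i j * (y * Φ j)) + sum (λ j → - ((y * x) * (t i j * Φ j)))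
          ≈⟨ +-cong (sum-𝟙 i (λ j → y * Φ j)) (trans (sum-neg (λ j → (y * x) * (t i j * Φ j)))
               (-‿cong (sym (*-distribˡ-sum (y * x) (λ j → t i j * Φ j))))) ⟩
        y * Φ i + - ((y * x) * sum λ j → t i j * Φ j)
          ≈⟨ +-congˡ (trans (-‿cong (*-assoc _ _ _)) (-‿distribʳ-* _ _)) ⟩
        y * Φ i + y * - (x * sum λ j → t i j * Φ j)
          ≈⟨ distribˡ _ _ _ ⟨
        y * (Φ i + - (x * sum λ j → t i j * Φ j)) ∎

-- Power series

module PowerSeriesRing (R : CommutativeRing c ℓ) where
  open CommutativeRing R hiding (rawRing; zero)
  open Determinant R
  open Algebra.Properties.Ring ring
  open Relation.Binary.Reasoning.Setoid setoid

  S : Set c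
  S = ℕ → Carrier

  infixl 7 _⋆_
  _⋆_ : S → S → S
  (f ⋆ g) n = sum {suc n} λ i → f (toℕ i) * g (n ℕ.∸ toℕ i)

  tail : S → S
  tail f n = f (suc n)

  -- The truncated form serves `⋆-inverse`, where the approximations of the inverse agree only up to
  -- order n.
  ⋆-cong-≤ : ∀ n {f f′ g g′ : S} → (∀ {i} → i ℕ.≤ n → f i ≈ f′ i) → (∀ {i} → i ℕ.≤ n → g i ≈ g′ i) →
    (f ⋆ g) n ≈ (f′ ⋆ g′) n
  ⋆-cong-≤ zero    f≈ g≈ = +-congʳ (*-cong (f≈ z≤n) (g≈ z≤n))
  ⋆-cong-≤ (suc n) f≈ g≈ = +-cong (*-cong (f≈ z≤n) (g≈ ℕ.≤-refl))
    (⋆-cong-≤ n (λ i≤n → f≈ (s≤s i≤n)) (λ i≤n → g≈ (ℕ.m≤n⇒m≤1+n i≤n)))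

  ⋆-cong : ∀ {f f′ g g′ : S} → (∀ n → f n ≈ f′ n) → (∀ n → g n ≈ g′ n) → ∀ n → (f ⋆ g) n ≈ (f′ ⋆ g′) n
  ⋆-cong f≈ g≈ n = ⋆-cong-≤ n (λ {i} _ → f≈ i) (λ {i} _ → g≈ i)

  ⋆-zeroˡ : ∀ (g : S) n → ((λ _ → 0#) ⋆ g) n ≈ 0#
  ⋆-zeroˡ g n = sum-zero {suc n} λ i → zeroˡ (g (n ℕ.∸ toℕ i))

  ⋆-const : ∀ x (g : S) n → (const (raw R) x ⋆ g) n ≈ x * g n
  ⋆-const x g zero    = +-identityʳ _
  ⋆-const x g (suc n) = trans (+-congˡ (⋆-zeroˡ g n)) (+-identityʳ _)

  ⋆-distribʳ : ∀ (h f g : S) n → ((λ n → f n + g n) ⋆ h) n ≈ (f ⋆ h) n + (g ⋆ h) n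
  ⋆-distribʳ h f g n = trans
    (sum-cong-≋ {suc n} λ i → distribʳ (h (n ℕ.∸ toℕ i)) (f (toℕ i)) (g (toℕ i)))
    (∑-distrib-+ {suc n} (λ i → f (toℕ i) * h (n ℕ.∸ toℕ i)) (λ i → g (toℕ i) * h (n ℕ.∸ toℕ i)))

  ⋆-scaleˡ : ∀ x (f g : S) n → ((λ n → x * f n) ⋆ g) n ≈ x * (f ⋆ g) n
  ⋆-scaleˡ x f g n = trans
    (sum-cong-≋ {suc n} λ i → *-assoc x (f (toℕ i)) (g (n ℕ.∸ toℕ i)))
    (sym (*-distribˡ-sum {suc n} x (λ i → f (toℕ i) * g (n ℕ.∸ toℕ i))))

  -- A product unfolds by peeling off its first summand. Commutativity needs this mirror image,
  -- which peels off the last.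
  ⋆-suc : ∀ (f g : S) n → (f ⋆ g) (suc n) ≈ (f ⋆ tail g) n + f (suc n) * g 0
  ⋆-suc f g zero    = trans (+-congˡ (+-identityʳ _)) (+-congʳ (sym (+-identityʳ _)))
  ⋆-suc f g (suc n) = trans (+-congˡ (⋆-suc (tail f) g n)) (sym (+-assoc _ _ _))

  ⋆-comm : ∀ (f g : S) n → (f ⋆ g) n ≈ (g ⋆ f) n
  ⋆-comm f g zero    = +-congʳ (*-comm _ _)
  ⋆-comm f g (suc n) = begin
    f 0 * g (suc n) + (tail f ⋆ g) n  ≈⟨ +-cong (*-comm _ _) (⋆-comm (tail f) g n) ⟩
    g (suc n) * f 0 + (g ⋆ tail f) n  ≈⟨ +-comm _ _ ⟩
    (g ⋆ tail f) n + g (suc n) * f 0  ≈⟨ ⋆-suc g f n ⟨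
    (g ⋆ f) (suc n)                   ∎

  ⋆-assoc : ∀ (f g h : S) n → ((f ⋆ g) ⋆ h) n ≈ (f ⋆ (g ⋆ h)) n
  ⋆-assoc f g h zero    = +-congʳ (trans (*-congʳ (+-identityʳ _))
    (trans (*-assoc _ _ _) (*-congˡ (sym (+-identityʳ _)))))
  ⋆-assoc f g h (suc n) = begin
    (f 0 * g 0 + 0#) * h (suc n) + (tail (f ⋆ g) ⋆ h) n
      ≈⟨ +-cong (*-congʳ (+-identityʳ _)) (⋆-distribʳ h (λ n → f 0 * g (suc n)) (tail f ⋆ g) n) ⟩
    f 0 * g 0 * h (suc n) + (((λ n → f 0 * tail g n) ⋆ h) n + ((tail f ⋆ g) ⋆ h) n)
      ≈⟨ +-cong (*-assoc _ _ _) (+-cong (⋆-scaleˡ (f 0) (tail g) h n) (⋆-assoc (tail f) g h n)) ⟩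
    f 0 * (g 0 * h (suc n)) + (f 0 * (tail g ⋆ h) n + (tail f ⋆ (g ⋆ h)) n)
      ≈⟨ +-assoc _ _ _ ⟨
    f 0 * (g 0 * h (suc n)) + f 0 * (tail g ⋆ h) n + (tail f ⋆ (g ⋆ h)) n
      ≈⟨ +-congʳ (distribˡ _ _ _) ⟨
    (f ⋆ (g ⋆ h)) (suc n) ∎

  ring⟦⟧ : CommutativeRing c ℓ
  ring⟦⟧ = record
    { Carrier = S
    ; _≈_ = λ f g → ∀ n → f n ≈ g n
    ; _+_ = λ f g n → f n + g n
    ; _*_ = _⋆_
    ; -_ = λ f n → - f n
    ; 0# = λ _ → 0#
    ; 1# = const (raw R) 1#
    ; isCommutativeRing = record
      { isRing = record
        { +-isAbelianGroup = record
          { isGroup = record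
            { isMonoid = record
              { isSemigroup = record
                { isMagma = record
                  { isEquivalence = record
                    { refl = λ _ → refl
                    ; sym = λ f≈g n → sym (f≈g n)
                    ; trans = λ f≈g g≈h n → trans (f≈g n) (g≈h n)
                    }
                  ; ∙-cong = λ f≈ g≈ n → +-cong (f≈ n) (g≈ n)
                  }
                ; assoc = λ f g h n → +-assoc _ _ _
                }
              ; identity = (λ f n → +-identityˡ _) , (λ f n → +-identityʳ _)
              }
            ; inverse = (λ f n → -‿inverseˡ _) , (λ f n → -‿inverseʳ _)
            ; ⁻¹-cong = λ f≈ n → -‿cong (f≈ n)
            }
          ; comm = λ f g n → +-comm _ _
          }
        ; *-cong = ⋆-cong
        ; *-assoc = ⋆-assoc
        ; *-identity = ⋆-identityˡ , λ f n → trans (⋆-comm f one n) (⋆-identityˡ f n)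
        ; distrib = ⋆-distribˡ , ⋆-distribʳ
        }
      ; *-comm = ⋆-comm
      }
    }
    where
    ⋆-distribˡ : ∀ (h f g : S) n → (h ⋆ (λ n → f n + g n)) n ≈ (h ⋆ f) n + (h ⋆ g) n
    ⋆-distribˡ h f g n = trans (⋆-comm h (λ n → f n + g n) n)
      (trans (⋆-distribʳ h f g n) (+-cong (⋆-comm f h n) (⋆-comm g h n)))
    one : S
    one = const (raw R) 1#
    ⋆-identityˡ : ∀ (f : S) n → (one ⋆ f) n ≈ f n
    ⋆-identityˡ f n = trans (⋆-const 1# f n) (*-identityˡ (f n))

  module R⟦⟧ = CommutativeRing ring⟦⟧
  module D⟦⟧ = Determinant ring⟦⟧

  ⋆-head : ∀ (f g : S) → (f ⋆ g) 0 ≈ f 0 * g 0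
  ⋆-head f g = +-identityʳ _

  sum-coeff : ∀ {m} (f : Fin m → S) n → D⟦⟧.sum f n ≈ sum (λ i → f i n)
  sum-coeff {zero}  f n = refl
  sum-coeff {suc m} f n = +-congˡ (sum-coeff (λ i → f (suc i)) n)

  det-head : ∀ {m} (M : D⟦⟧.Matrix m) → D⟦⟧.det M 0 ≈ det (λ i j → M i j 0)
  det-head {zero}  M = refl
  det-head {suc m} M = trans (sum-coeff (λ i → D⟦⟧.sgn (toℕ i) ⋆ (M i zero ⋆ D⟦⟧.det (D⟦⟧.minor M i zero))) 0)
    (sum-cong-≋ λ i → trans (⋆-head (D⟦⟧.sgn (toℕ i)) (M i zero ⋆ D⟦⟧.det (D⟦⟧.minor M i zero)))
      (*-cong (sgn-head (toℕ i)) (trans (⋆-head (M i zero) (D⟦⟧.det (D⟦⟧.minor M i zero)))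
        (*-congˡ {M i zero 0} (det-head (D⟦⟧.minor M i zero))))))
    where
    sgn-head : ∀ k → D⟦⟧.sgn k 0 ≈ sgn k
    sgn-head zero    = refl
    sgn-head (suc k) = trans (⋆-head (R⟦⟧.- R⟦⟧.1#) (D⟦⟧.sgn k)) (*-congˡ (sgn-head k))

  module _ (f : S) (f₀≈1 : f 0 ≈ 1#) where
    -- approx n is (1 + z h)⁻¹ modulo zⁿ⁺¹, where f = 1 + z h.
    approx : ℕ → S
    approx n       zero    = 1#
    approx zero    (suc k) = 0#
    approx (suc n) (suc k) = - (tail f ⋆ approx n) k

    approx-stable : ∀ {m n} k → k ℕ.≤ m → k ℕ.≤ n → approx m k ≈ approx n k
    approx-stable zero    k≤m k≤n = refl
    approx-stable (suc k) (s≤s k≤m) (s≤s k≤n) = -‿cong (⋆-cong-≤ k {tail f} (λ _ → refl)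
      (λ i≤k → approx-stable _ (ℕ.≤-trans i≤k k≤m) (ℕ.≤-trans i≤k k≤n)))

    inverse : S
    inverse n = approx n n

    ⋆-inverse : ∀ n → (f ⋆ inverse) n ≈ R⟦⟧.1# n
    ⋆-inverse zero    = trans (+-identityʳ _) (trans (*-identityʳ _) f₀≈1)
    ⋆-inverse (suc n) = begin
      f 0 * - (tail f ⋆ approx n) n + (tail f ⋆ inverse) n
        ≈⟨ +-cong (trans (*-congʳ f₀≈1) (*-identityˡ _))
             (⋆-cong-≤ n {tail f} (λ _ → refl) (λ {i} i≤n → approx-stable i ℕ.≤-refl i≤n)) ⟩
      - (tail f ⋆ approx n) n + (tail f ⋆ approx n) n
        ≈⟨ -‿inverseˡ _ ⟩
      0# ∎

    invertible : Algebra.Definitions.Invertible R⟦⟧._≈_ R⟦⟧.1# _⋆_ f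
    invertible = inverse , (λ n → trans (⋆-comm inverse f n) (⋆-inverse n)) , ⋆-inverse

  z z² : S
  z  = var (raw R)
  z² = z ⋆ z

  z⋆-zero : ∀ (f : S) → (z ⋆ f) 0 ≈ 0#
  z⋆-zero f = trans (+-identityʳ _) (zeroˡ _)

  z⋆-suc : ∀ (f : S) n → (z ⋆ f) (suc n) ≈ f n
  z⋆-suc f n = begin
    0# * f (suc n) + (tail z ⋆ f) n  ≈⟨ trans (+-congʳ (zeroˡ _)) (+-identityˡ _) ⟩
    (tail z ⋆ f) n                   ≈⟨ ⋆-cong {tail z} {R⟦⟧.1#} {f} (λ { zero → refl ; (suc _) → refl }) (λ _ → refl) n ⟩
    (R⟦⟧.1# ⋆ f) n                   ≈⟨ R⟦⟧.*-identityˡ f n ⟩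
    f n                              ∎

  z²⋆-suc : ∀ (f : S) n → (z² ⋆ f) (2 ℕ.+ n) ≈ f n
  z²⋆-suc f n = trans (⋆-assoc z z f (2 ℕ.+ n)) (trans (z⋆-suc (z ⋆ f) (suc n)) (z⋆-suc f n))

  -- Polynomials among the power series

  module _ (P : Subring R ℓ′) where
    open Subring P

    EventuallyZero : S → Set ℓ
    EventuallyZero f = ∃[ d ] (∀ k → d ℕ.≤ k → f k ≈ 0#)

    -- With `full` for P this is K[z]. Applied twice it is K[u][z]: requiring the coefficients to
    -- lie in P excludes polynomials in z whose coefficients are infinite series in u.
    polynomials : Subring ring⟦⟧ (ℓ ⊔ ℓ′)
    polynomials = record
      { Member = λ f → EventuallyZero f × (∀ k → Member (f k))
      ; resp = λ f≈g ((d , f≈0) , f∈) →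
          (d , λ k d≤k → trans (sym (f≈g k)) (f≈0 k d≤k)) , λ k → resp (f≈g k) (f∈ k)
      ; 0∈ = (0 , λ _ _ → refl) , λ _ → 0∈
      ; 1∈ = (1 , λ { (suc k) _ → refl }) , λ { zero → 1∈ ; (suc k) → 0∈ }
      ; +-∈ = λ ((d , f≈0) , f∈) ((e , g≈0) , g∈) →
          (d ℕ.+ e , λ k d+e≤k → trans (+-cong (f≈0 k (ℕ.m+n≤o⇒m≤o d d+e≤k)) (g≈0 k (ℕ.m+n≤o⇒n≤o d d+e≤k))) (+-identityˡ 0#)) ,
          λ k → +-∈ (f∈ k) (g∈ k)
      ; *-∈ = λ {f} {g} ((d , f≈0) , f∈) ((e , g≈0) , g∈) →
          (d ℕ.+ e , λ k d+e≤k → sum-zero {suc k} λ i → vanish {f} {g} {d} {e} f≈0 g≈0 d+e≤k (toℕ i) (d ℕ.≤? toℕ i)) ,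
          λ k → sum-∈ P {suc k} λ i → *-∈ (f∈ (toℕ i)) (g∈ (k ℕ.∸ toℕ i))
      ; -‿∈ = λ ((d , f≈0) , f∈) → (d , λ k d≤k → trans (-‿cong (f≈0 k d≤k)) -0#≈0#) , λ k → -‿∈ (f∈ k)
      }
      where
      vanish : ∀ {f g : S} {d e k} → (∀ k → d ℕ.≤ k → f k ≈ 0#) → (∀ k → e ℕ.≤ k → g k ≈ 0#) →
        d ℕ.+ e ℕ.≤ k → ∀ i → Dec (d ℕ.≤ i) → f i * g (k ℕ.∸ i) ≈ 0#
      vanish f≈0 g≈0 d+e≤k i (yes d≤i) = trans (*-congʳ (f≈0 i d≤i)) (zeroˡ _)
      vanish {d = d} {e} {k} f≈0 g≈0 d+e≤k i (no d≰i) = trans (*-congˡ (g≈0 (k ℕ.∸ i)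
        (ℕ.≤-trans (ℕ.≤-reflexive (≡.sym (ℕ.m+n∸m≡n d e))) (ℕ.∸-mono d+e≤k (ℕ.<⇒≤ (ℕ.≰⇒> d≰i)))))) (zeroʳ _)

  full : Subring R 0ℓ
  full = record
    { Member = λ _ → ⊤ ; resp = λ _ _ → tt ; 0∈ = tt ; 1∈ = tt
    ; +-∈ = λ _ _ → tt ; *-∈ = λ _ _ → tt ; -‿∈ = λ _ → tt }

-- Subsets of an interval

-- Increasing lists are canonical representatives of finite sets: inclusion and equal length give
-- equality (`sorted-⊆-≡`), so the equation of sets in the definition of T becomes an equation of
-- lists.
Sorted : List ℤ → Set
Sorted = AllPairs ℤ._<_

∈-tail : ∀ {A : Set} {x y : A} {ys} → x ≢ y → x ∈ y ∷ ys → x ∈ ys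
∈-tail x≢y (here x≡y)   = contradiction x≡y x≢y
∈-tail x≢y (there x∈ys) = x∈ys

sorted-head-≤ : ∀ {x y ys} → Sorted (y ∷ ys) → x ∈ y ∷ ys → y ℤ.≤ x
sorted-head-≤ _           (here ≡.refl) = ℤ.≤-refl
sorted-head-≤ (y<ys ∷ _) (there x∈ys)  = ℤ.<⇒≤ (All.lookup y<ys x∈ys)

sorted-⊆-length : ∀ {xs ys} → Sorted xs → Sorted ys → xs ⊆ ys → length xs ℕ.≤ length ys
sorted-⊆-≡ : ∀ {xs ys} → Sorted xs → Sorted ys → xs ⊆ ys → length xs ≡ length ys → xs ≡ ys

-- The head y is at most x, hence strictly below every element of `xs`.
⊆-tails : ∀ {x xs y ys} → Sorted (x ∷ xs) → Sorted (y ∷ ys) → x ∷ xs ⊆ y ∷ ys → xs ⊆ ys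
⊆-tails (x<xs ∷ _) sys xs⊆ys z∈xs = ∈-tail
  (λ { ≡.refl → ℤ.<-irrefl ≡.refl (ℤ.≤-<-trans (sorted-head-≤ sys (xs⊆ys (here ≡.refl))) (All.lookup x<xs z∈xs)) })
  (xs⊆ys (there z∈xs))

sorted-⊆-length {[]}     _ _ _ = z≤n
sorted-⊆-length {x ∷ xs} {[]} _ _ xs⊆ys with () ← xs⊆ys (here ≡.refl)
sorted-⊆-length {x ∷ xs} {y ∷ ys} sxs@(_ ∷ sxs′) sys@(_ ∷ sys′) xs⊆ys =
  s≤s (sorted-⊆-length sxs′ sys′ (⊆-tails sxs sys xs⊆ys))

sorted-⊆-≡ {[]}     {[]}     _ _ _ _ = ≡.refl
sorted-⊆-≡ {x ∷ xs} {y ∷ ys} sxs@(x<xs ∷ sxs′) sys@(_ ∷ sys′) xs⊆ys eq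
  with xs⊆ys (here ≡.refl)
... | here ≡.refl = ≡.cong (x ∷_) (sorted-⊆-≡ sxs′ sys′ (⊆-tails sxs sys xs⊆ys) (ℕ.suc-injective eq))
-- Otherwise all of x ∷ xs would be contained in `ys`, which is one element too short.
... | there x∈ys = contradiction
  (sorted-⊆-length sxs sys′ λ { (here ≡.refl) → x∈ys ; (there z∈xs) → ⊆-tails sxs sys xs⊆ys z∈xs })
  (ℕ.<⇒≱ (ℕ.≤-reflexive (≡.sym eq)))

map-sorted : ∀ {f : ℤ → ℤ} → (∀ {x y} → x ℤ.< y → f x ℤ.< f y) → ∀ {xs} → Sorted xs → Sorted (map f xs)
map-sorted mono sxs = AllPairs.map⁺ (AllPairs.map mono sxs)

-- Pick p s xs ys: the entry of xs at position p is s, and ys is the rest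
-- of xs.
data Pick : ℕ → ℤ → List ℤ → List ℤ → Set where
  here  : ∀ {x xs} → Pick 0 x (x ∷ xs) xs
  there : ∀ {p s x xs ys} → Pick p s xs ys → Pick (suc p) s (x ∷ xs) (x ∷ ys)

module _ where
  private
    variable
      p q : ℕ
      s s′ : ℤ
      xs ys ys′ : List ℤ

  Pick-⊇ : Pick p s xs ys → s ∷ ys ⊆ xs
  Pick-⊇ here      z∈              = z∈
  Pick-⊇ (there π) (here z≡s)           = there (Pick-⊇ π (here z≡s))
  Pick-⊇ (there π) (there (here z≡x))   = here z≡x
  Pick-⊇ (there π) (there (there z∈ys)) = there (Pick-⊇ π (there z∈ys))

  Pick-⊆ : Pick p s xs ys → xs ⊆ s ∷ ys
  Pick-⊆ here      z∈ = z∈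
  Pick-⊆ (there π) (here z≡x)   = there (here z≡x)
  Pick-⊆ (there π) (there z∈xs) with Pick-⊆ π z∈xs
  ... | here z≡s   = here z≡s
  ... | there z∈ys = there (there z∈ys)

  Pick-length : Pick p s xs ys → length xs ≡ suc (length ys)
  Pick-length here      = ≡.refl
  Pick-length (there π) = ≡.cong suc (Pick-length π)

  Pick-< : Pick p s xs ys → p ℕ.< length xs
  Pick-< here      = s≤s z≤n
  Pick-< (there π) = s≤s (Pick-< π)

  Pick-∃ : s ∈ xs → ∃[ p ] ∃[ ys ] Pick p s xs ys
  Pick-∃ (here ≡.refl) = _ , _ , here
  Pick-∃ (there s∈xs)  = let _ , _ , π = Pick-∃ s∈xs in _ , _ , there π

  Pick-functional : Pick p s xs ys → Pick p s′ xs ys′ → s ≡ s′ × ys ≡ ys′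
  Pick-functional here      here      = ≡.refl , ≡.refl
  Pick-functional (there π) (there ρ) with Pick-functional π ρ
  ... | ≡.refl , ≡.refl = ≡.refl , ≡.refl

  Pick-sorted : Pick p s xs ys → Sorted xs → Sorted ys
  Pick-sorted here      (_ ∷ sxs)    = sxs
  Pick-sorted (there π) (x<xs ∷ sxs) =
    All.tabulate (λ z∈ys → All.lookup x<xs (Pick-⊇ π (there z∈ys))) ∷ Pick-sorted π sxs

  Pick-∉ : Pick p s xs ys → Sorted xs → s ∉ ys
  Pick-∉ here      (x<xs ∷ _)   s∈ys          = ℤ.<-irrefl ≡.refl (All.lookup x<xs s∈ys)
  Pick-∉ (there π) (x<xs ∷ _)   (here ≡.refl) = ℤ.<-irrefl ≡.refl (All.lookup x<xs (Pick-⊇ π (here ≡.refl)))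
  Pick-∉ (there π) (_ ∷ sxs)    (there s∈ys)  = Pick-∉ π sxs s∈ys

  Pick-injective : Sorted xs → Pick p s xs ys → Pick q s′ xs ys → p ≡ q
  Pick-injective _            here      here      = ≡.refl
  Pick-injective (x<xs ∷ _)   here      (there ρ) = contradiction (All.lookup x<xs (here ≡.refl)) (ℤ.<-irrefl ≡.refl)
  Pick-injective (x<xs ∷ _)   (there π) here      = contradiction (All.lookup x<xs (here ≡.refl)) (ℤ.<-irrefl ≡.refl)
  Pick-injective (_ ∷ sxs)    (there π) (there ρ) = ≡.cong suc (Pick-injective sxs π ρ)

  -- This identifies the sign ε_s(I) with the Laplace sign (-1)^p. In an increasing list the
  -- position of s is the number of smaller elements, and the last entry t is smaller than none.
  Pick-count : ∀ I {t} → Sorted (I ∷ʳ t) → Pick p s (I ∷ʳ t) ys → length (filter (ℤ._<? s) I) ≡ p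
  Pick-count [] _ here = ≡.refl
  Pick-count (x ∷ I) (x< ∷ _) here = ≡.cong length
    (List.filter-none (ℤ._<? x) {xs = x ∷ I} (ℤ.<-irrefl ≡.refl ∷ All.map ℤ.<-asym (All.++⁻ˡ I x<)))
  Pick-count {s = s} (x ∷ I) (x< ∷ sI) (there π) = ≡.trans
    (≡.cong length (List.filter-accept (ℤ._<? s) {xs = I} (All.lookup x< (Pick-⊇ π (here ≡.refl)))))
    (≡.cong suc (Pick-count I sI π))

sorted-∷ʳ : ∀ {I t} → Sorted I → All (ℤ._< t) I → Sorted (I ∷ʳ t)
sorted-∷ʳ sI I<t = AllPairs.++⁺ sI ([] ∷ []) (All.map (_∷ []) I<t)

-- The columns I, t, t + 1, t + 2, …
column : ℕ → List ℤ → ℕ → ℤ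
column t []      j       = + (t ℕ.+ j)
column t (x ∷ I) zero    = x
column t (x ∷ I) (suc j) = column t I j

delete : ℕ → List ℤ → List ℤ
delete p       []       = []
delete zero    (x ∷ xs) = xs
delete (suc p) (x ∷ xs) = x ∷ delete p xs

-- If s is at position p of I ∪ {t}, then I ∪ {t} = (next t I p + 1) ∪ {s}.
next : ℕ → List ℤ → ℕ → List ℤ
next t I p = map ℤ.pred (delete p (I ∷ʳ + t))

skip : ℕ → ℕ → ℕ
skip zero    s       = suc s
skip (suc p) zero    = zero
skip (suc p) (suc s) = suc (skip p s)

Pick-delete : ∀ t I {p} → p ℕ.≤ length I → Pick p (column t I p) (I ∷ʳ + t) (delete p (I ∷ʳ + t))
Pick-delete t []      {zero}  _ rewrite ℕ.+-identityʳ t = here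
Pick-delete t (x ∷ I) {zero}  _         = here
Pick-delete t (x ∷ I) {suc p} (s≤s p≤) = there (Pick-delete t I p≤)

column-∷ʳ : ∀ t I j → column (suc t) (I ∷ʳ + t) j ≡ column t I j
column-∷ʳ t []      zero    = ≡.cong +_ (≡.sym (ℕ.+-identityʳ t))
column-∷ʳ t []      (suc j) = ≡.cong +_ (≡.sym (ℕ.+-suc t j))
column-∷ʳ t (x ∷ I) zero    = ≡.refl
column-∷ʳ t (x ∷ I) (suc j) = column-∷ʳ t I j

column-map-pred : ∀ t I j → column t (map ℤ.pred I) j ≡ ℤ.pred (column (suc t) I j)
column-map-pred t []      j       = ≡.refl
column-map-pred t (x ∷ I) zero    = ≡.refl
column-map-pred t (x ∷ I) (suc j) = column-map-pred t I j

column-delete : ∀ t I {p} j → p ℕ.< length I → column t (delete p I) j ≡ column t I (skip p j)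
column-delete t (x ∷ I) {zero}  j       _         = ≡.refl
column-delete t (x ∷ I) {suc p} zero    _         = ≡.refl
column-delete t (x ∷ I) {suc p} (suc j) (s≤s p<) = column-delete t I j p<

length-∷ʳ : ∀ (I : List ℤ) x → length (I ∷ʳ x) ≡ suc (length I)
length-∷ʳ I x = ≡.trans (List.length-++ I) (ℕ.+-comm (length I) 1)

-- Deleting position p leaves the rest of I ∪ {t}, followed by t + 1, t + 2, .... Lowering by 1
-- brings the infinite part back to t, t + 1, ..., so a minor has the same shape as the determinant
-- it comes from.
column-next : ∀ t I {p} j → p ℕ.≤ length I → column t (next t I p) j ≡ ℤ.pred (column t I (skip p j))
column-next t I {p} j p≤ = ≡.trans (column-map-pred t (delete p (I ∷ʳ + t)) j) (≡.cong ℤ.pred (≡.trans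
  (column-delete (suc t) (I ∷ʳ + t) j (≡.subst (p ℕ.<_) (≡.sym (length-∷ʳ I (+ t))) (s≤s p≤)))
  (column-∷ʳ t I (skip p j))))

column-≥ : ∀ t I j → column t I (length I ℕ.+ j) ≡ + (t ℕ.+ j)
column-≥ t []      j = ≡.refl
column-≥ t (x ∷ I) j = column-≥ t I j

column-∈ : ∀ {t I x} → x ∈ I → ∃[ j ] j ℕ.< length I × column t I j ≡ x
column-∈ (here ≡.refl) = 0 , s≤s z≤n , ≡.refl
column-∈ (there x∈I)   = let j , j< , eq = column-∈ x∈I in suc j , s≤s j< , eq

range : ℕ → ℕ → List ℤ
range s zero    = []
range s (suc n) = + s ∷ range (suc s) n

column-range : ∀ s n j → column (s ℕ.+ n) (range s n) j ≡ + (s ℕ.+ j)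
column-range s zero    j       = ≡.cong (λ k → + (k ℕ.+ j)) (ℕ.+-identityʳ s)
column-range s (suc n) zero    = ≡.cong +_ (≡.sym (ℕ.+-identityʳ s))
column-range s (suc n) (suc j) rewrite ℕ.+-suc s n | ℕ.+-suc s j = column-range (suc s) n j

length-range : ∀ s n → length (range s n) ≡ n
length-range s zero    = ≡.refl
length-range s (suc n) = ≡.cong suc (length-range (suc s) n)

range-bounds : ∀ s n → All (λ x → + s ℤ.≤ x × x ℤ.< + (s ℕ.+ n)) (range s n)
range-bounds s zero    = []
range-bounds s (suc n) = (ℤ.≤-refl , ℤ.+<+ (ℕ.m<m+n s (s≤s z≤n))) ∷
  All.map (λ {x} (s<x , x<) → ℤ.<⇒≤ (ℤ.suc[i]≤j⇒i<j s<x) , ≡.subst (x ℤ.<_) (≡.cong +_ (≡.sym (ℕ.+-suc s n))) x<)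
    (range-bounds (suc s) n)

range-sorted : ∀ s n → Sorted (range s n)
range-sorted s zero    = []
range-sorted s (suc n) =
  All.map (λ (s<x , _) → ℤ.suc[i]≤j⇒i<j s<x) (range-bounds (suc s) n) ∷ range-sorted (suc s) n

∈-subsets⁻ : ∀ k {X J} → Sorted X → J ∈ subsets k X → length J ≡ k × Sorted J × J ⊆ X
∈-subsets⁻ zero    _ (here ≡.refl) = ≡.refl , [] , λ ()
∈-subsets⁻ (suc k) {x ∷ X} (x<X ∷ sX) J∈ with ∈-++⁻ (map (x ∷_) (subsets k X)) J∈
... | inj₂ J∈₂ = let eq , sJ , J⊆X = ∈-subsets⁻ (suc k) sX J∈₂ in eq , sJ , λ z∈J → there (J⊆X z∈J)
... | inj₁ J∈₁ with ∈-map⁻ (x ∷_) J∈₁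
... | J′ , J′∈ , ≡.refl = let eq , sJ , J⊆X = ∈-subsets⁻ k sX J′∈ in
  ≡.cong suc eq , All.tabulate (λ z∈J → All.lookup x<X (J⊆X z∈J)) ∷ sJ ,
  λ { (here z≡x) → here z≡x ; (there z∈J) → there (J⊆X z∈J) }

∈-subsets⁺ : ∀ {X J} → Sorted X → Sorted J → J ⊆ X → J ∈ subsets (length J) X
∈-subsets⁺ {J = []}             _          _          _   = here ≡.refl
∈-subsets⁺ {[]}    {y ∷ J} _ _ J⊆X with () ← J⊆X (here ≡.refl)
∈-subsets⁺ {x ∷ X} {y ∷ J} sX@(x<X ∷ sX′) sJ@(y<J ∷ sJ′) J⊆X with J⊆X (here ≡.refl)
... | here ≡.refl = ∈-++⁺ˡ (∈-map⁺ (x ∷_) (∈-subsets⁺ sX′ sJ′ (⊆-tails sJ sX J⊆X)))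
... | there y∈X = ∈-++⁺ʳ _ (∈-subsets⁺ sX′ sJ λ { (here ≡.refl) → y∈X ; (there z∈J) → ⊆-tails sJ sX J⊆X z∈J })

subsets-unique : ∀ k {X} → Sorted X → Unique (subsets k X)
subsets-unique zero    _ = [] ∷ []
subsets-unique (suc k) {[]} _ = []
subsets-unique (suc k) {x ∷ X} (x<X ∷ sX) = Unique.++⁺
  (Unique.map⁺ List.∷-injectiveʳ (subsets-unique k sX)) (subsets-unique (suc k) sX)
  λ (J∈₁ , J∈₂) → let J′ , _ , J≡ = ∈-map⁻ (x ∷_) J∈₁
                      _ , _ , J⊆X = ∈-subsets⁻ (suc k) sX J∈₂
                  in ℤ.<-irrefl ≡.refl (All.lookup x<X (J⊆X (≡.subst (x ∈_) (≡.sym J≡) (here ≡.refl))))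

lookup-injective : ∀ {A : Set} {xs : List A} → Unique xs → ∀ i j → lookup xs i ≡ lookup xs j → i ≡ j
lookup-injective (_ ∷ _)    zero    zero    _  = ≡.refl
lookup-injective (x∉ ∷ _)   zero    (suc j) eq = contradiction eq (All.lookup x∉ (∈-lookup j))
lookup-injective (x∉ ∷ _)   (suc i) zero    eq = contradiction (≡.sym eq) (All.lookup x∉ (∈-lookup i))
lookup-injective (_ ∷ uxs)  (suc i) (suc j) eq = ≡.cong suc (lookup-injective uxs i j eq)

interval-sorted : ∀ m n → Sorted (interval m n)
interval-sorted m n = AllPairs.map⁺ (AllPairs.applyUpTo⁺₁ (λ i → i) _ λ i<j _ → ℤ.+-monoʳ-< m (ℤ.+<+ i<j))

m+[x-m]≡x : ∀ m x → m ℤ.+ (x ℤ.- m) ≡ x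
m+[x-m]≡x m x = ≡.trans (ℤ.+-comm m _) (≡.trans (ℤ.+-assoc x (ℤ.- m) m)
  (≡.trans (≡.cong (λ i → x ℤ.+ i) (ℤ.+-inverseˡ m)) (ℤ.+-identityʳ x)))

∈-interval⁺ : ∀ {m n x} → m ℤ.≤ x → x ℤ.≤ n → x ∈ interval m n
∈-interval⁺ {m} {n} {x} m≤x x≤n = ≡.subst (_∈ interval m n) m+k≡x
  (∈-map⁺ (λ i → m ℤ.+ + i) (∈-upTo⁺ (ℤ.drop‿+<+ (begin-strict
    + k                            ≡⟨ +k≡x-m ⟩
    x ℤ.- m                        <⟨ ℤ.suc[i]≤j⇒i<j ℤ.≤-refl ⟩
    1ℤ ℤ.+ (x ℤ.- m)               ≡⟨ ℤ.+-assoc 1ℤ x (ℤ.- m) ⟨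
    1ℤ ℤ.+ x ℤ.- m                 ≤⟨ ℤ.+-monoˡ-≤ (ℤ.- m) (ℤ.+-monoʳ-≤ 1ℤ x≤n) ⟩
    1ℤ ℤ.+ n ℤ.- m                 ≤⟨ ℤ.i≤j⊔i 0ℤ _ ⟩
    0ℤ ℤ.⊔ (1ℤ ℤ.+ n ℤ.- m)        ≡⟨ ℤ.0≤i⇒+∣i∣≡i (ℤ.i≤i⊔j 0ℤ _) ⟨
    + ∣ 0ℤ ℤ.⊔ (1ℤ ℤ.+ n ℤ.- m) ∣  ∎))))
  where
  open ℤ.≤-Reasoning
  k = ∣ x ℤ.- m ∣
  +k≡x-m : + k ≡ x ℤ.- m
  +k≡x-m = ℤ.0≤i⇒+∣i∣≡i (ℤ.i≤j⇒0≤j-i m≤x)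
  m+k≡x : m ℤ.+ + k ≡ x
  m+k≡x = ≡.trans (≡.cong (λ i → m ℤ.+ i) +k≡x-m) (m+[x-m]≡x m x)

∈-interval⁻ : ∀ {m n x} → x ∈ interval m n → m ℤ.≤ x × x ℤ.≤ n
∈-interval⁻ {m} {n} x∈ with ∈-map⁻ (λ i → m ℤ.+ + i) x∈
... | i , i∈ , ≡.refl with ℤ.⊔-sel 0ℤ (1ℤ ℤ.+ n ℤ.- m)
...   | inj₁ eq rewrite eq with () ← ∈-upTo⁻ i∈
...   | inj₂ eq = ℤ.i≤i+j m (+ i) , ≡.subst (m ℤ.+ + i ℤ.≤_) (ℤ.pred-suc n) (ℤ.i<j⇒i≤pred[j]
  (≡.subst (m ℤ.+ + i ℤ.<_) (m+[x-m]≡x m (1ℤ ℤ.+ n)) (ℤ.+-monoʳ-< m (begin-strict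
    + i                            <⟨ ℤ.+<+ (∈-upTo⁻ i∈) ⟩
    + ∣ 0ℤ ℤ.⊔ (1ℤ ℤ.+ n ℤ.- m) ∣  ≡⟨ ℤ.0≤i⇒+∣i∣≡i (ℤ.i≤i⊔j 0ℤ _) ⟩
    0ℤ ℤ.⊔ (1ℤ ℤ.+ n ℤ.- m)        ≡⟨ eq ⟩
    1ℤ ℤ.+ n ℤ.- m                 ∎))))
  where open ℤ.≤-Reasoning

-- Expansion along the transfer matrix

_≟ᴸ_ : (I J : List ℤ) → Dec (I ≡ J)
_≟ᴸ_ = List.≡-dec ℤ._≟_

record IsState (m : ℤ) (t : ℕ) (I : List ℤ) : Set where
  field
    length≡ : length I ≡ t
    sorted  : Sorted I
    lower   : ∀ {x} → x ∈ I → m ℤ.≤ x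
    upper   : All (ℤ._< + t) I

∷ʳ⊆∷ : ∀ {I : List ℤ} {t} → I ∷ʳ t ⊆ t ∷ I
∷ʳ⊆∷ {I} z∈ with ∈-++⁻ I z∈
... | inj₁ z∈I         = there z∈I
... | inj₂ (here z≡t)  = here z≡t

∷⊆∷ʳ : ∀ {I : List ℤ} {t} → t ∷ I ⊆ I ∷ʳ t
∷⊆∷ʳ {I} (here z≡t)  = ∈-++⁺ʳ I (here z≡t)
∷⊆∷ʳ     (there z∈I) = ∈-++⁺ˡ z∈I

map-suc-pred : ∀ L → map ℤ.suc (map ℤ.pred L) ≡ L
map-suc-pred L = ≡.trans (≡.sym (List.map-∘ L)) (≡.trans (List.map-cong ℤ.suc-pred L) (List.map-id L))

map-pred-suc : ∀ L → map ℤ.pred (map ℤ.suc L) ≡ L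
map-pred-suc L = ≡.trans (≡.sym (List.map-∘ L)) (≡.trans (List.map-cong ℤ.pred-suc L) (List.map-id L))

column-tail : ∀ {m t I} → IsState m t I → ∀ {p} → t ℕ.≤ p → column t I p ≡ + p
column-tail {t = t} {I} I-state {p} t≤p = ≡.subst (λ q → column t I q ≡ + q) (ℕ.m+[n∸m]≡n t≤p)
  (≡.subst (λ k → column t I (k ℕ.+ (p ℕ.∸ t)) ≡ + (t ℕ.+ (p ℕ.∸ t))) (IsState.length≡ I-state) (column-≥ t I (p ℕ.∸ t)))

module _ {m t I} (I-state : IsState m t I) where
  open IsState I-state

  pick : ∀ {p} → p ℕ.≤ t → Pick p (column t I p) (I ∷ʳ + t) (delete p (I ∷ʳ + t))
  pick p≤t = Pick-delete t I (≡.subst (_ ℕ.≤_) (≡.sym length≡) p≤t)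

  sorted∷ʳ : Sorted (I ∷ʳ + t)
  sorted∷ʳ = sorted-∷ʳ sorted upper

  length-delete : ∀ {p} → p ℕ.≤ t → length (delete p (I ∷ʳ + t)) ≡ t
  length-delete p≤t = ℕ.suc-injective (≡.trans (≡.sym (Pick-length (pick p≤t)))
    (≡.trans (length-∷ʳ I (+ t)) (≡.cong suc length≡)))

  next-length : ∀ {p} → p ℕ.≤ t → length (next t I p) ≡ t
  next-length {p} p≤t = ≡.trans (List.length-map ℤ.pred (delete p (I ∷ʳ + t))) (length-delete p≤t)

  -- Removing one of t + 1 elements that are at most t, and lowering the others by 1, preserves
  -- everything except possibly the lower bound, which is therefore a hypothesis.
  next-state : ∀ {p} → p ℕ.≤ t → (∀ {x} → x ∈ next t I p → m ℤ.≤ x) → IsState m t (next t I p)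
  next-state {p} p≤t ≥m = record
    { length≡ = next-length p≤t
    ; sorted  = map-sorted (ℤ.+-monoʳ-< ℤ.-1ℤ) (Pick-sorted (pick p≤t) sorted∷ʳ)
    ; lower   = ≥m
    ; upper   = All.tabulate upper′
    }
    where
    upper′ : ∀ {x} → x ∈ next t I p → x ℤ.< + t
    upper′ x∈ with ∈-map⁻ ℤ.pred x∈
    ... | y , y∈ , ≡.refl with ∷ʳ⊆∷ (Pick-⊇ (pick p≤t) (there y∈))
    ...   | here ≡.refl = ℤ.i≤pred[j]⇒i<j ℤ.≤-refl
    ...   | there y∈I   = ℤ.≤-<-trans (ℤ.i≤j⇒pred[i]≤j ℤ.≤-refl) (All.lookup upper y∈I)

  -- The integer s lies in I ∪ {t}, at some position p. The remaining elements differ from s, so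
  -- they lie in J + 1, and equal lengths force equality.
  shift⇒next : ∀ {J s} → IsState m t J → (+ t ∷ I) ≋ (s ∷ map ℤ.suc J) →
    ∃[ p ] p ℕ.≤ t × column t I p ≡ s × next t I p ≡ J × length (filter (ℤ._<? s) I) ≡ p
  shift⇒next {J} {s} J-state (I⊆ , J⊆) with Pick-∃ (∷⊆∷ʳ (J⊆ (here ≡.refl)))
  ... | p , L , π = p , p≤t , proj₁ s,L≡ , next≡ , Pick-count I sorted∷ʳ π
    where
    p≤t : p ℕ.≤ t
    p≤t = ℕ.≤-pred (≡.subst (p ℕ.<_) (≡.trans (length-∷ʳ I (+ t)) (≡.cong suc length≡)) (Pick-< π))
    s,L≡ : column t I p ≡ s × delete p (I ∷ʳ + t) ≡ L
    s,L≡ = Pick-functional (pick p≤t) π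
    L⊆ : L ⊆ map ℤ.suc J
    L⊆ {z} z∈L = ∈-tail (λ { ≡.refl → Pick-∉ π sorted∷ʳ z∈L }) (I⊆ (∷ʳ⊆∷ (Pick-⊇ π (there z∈L))))
    L≡ : L ≡ map ℤ.suc J
    L≡ = sorted-⊆-≡ (Pick-sorted π sorted∷ʳ) (map-sorted (ℤ.+-monoʳ-< 1ℤ) (IsState.sorted J-state)) L⊆
      (≡.trans (≡.cong length (≡.sym (proj₂ s,L≡))) (≡.trans (length-delete p≤t)
        (≡.sym (≡.trans (List.length-map ℤ.suc J) (IsState.length≡ J-state)))))
    next≡ : next t I p ≡ J
    next≡ = ≡.trans (≡.cong (map ℤ.pred) (≡.trans (proj₂ s,L≡) L≡)) (map-pred-suc J)

  next⇒shift : ∀ {p} → p ℕ.≤ t → (+ t ∷ I) ≋ (column t I p ∷ map ℤ.suc (next t I p))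
  next⇒shift {p} p≤t rewrite map-suc-pred (delete p (I ∷ʳ + t)) =
    (λ z∈ → Pick-⊆ (pick p≤t) (∷⊆∷ʳ z∈)) , (λ z∈ → ∷ʳ⊆∷ (Pick-⊇ (pick p≤t) z∈))

  next-injective : ∀ {p q} → p ℕ.≤ t → q ℕ.≤ t → next t I p ≡ next t I q → p ≡ q
  next-injective {p} {q} p≤t q≤t eq = Pick-injective sorted∷ʳ (pick p≤t)
    (≡.subst (Pick q (column t I q) (I ∷ʳ + t)) (≡.sym deleted≡) (pick q≤t))
    where
    deleted≡ : delete p (I ∷ʳ + t) ≡ delete q (I ∷ʳ + t)
    deleted≡ = ≡.trans (≡.sym (map-suc-pred _)) (≡.trans (≡.cong (map ℤ.suc) eq) (map-suc-pred _))

∈-index⁻ : ∀ {m t I} → I ∈ subsets t (interval m (+ t ℤ.- 1ℤ)) → IsState m t I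
∈-index⁻ {m} {t} I∈ = let eq , sI , I⊆ = ∈-subsets⁻ t (interval-sorted m (+ t ℤ.- 1ℤ)) I∈ in record
  { length≡ = eq
  ; sorted  = sI
  ; lower   = λ x∈ → proj₁ (∈-interval⁻ {m} {+ t ℤ.- 1ℤ} (I⊆ x∈))
  ; upper   = All.tabulate λ x∈ → ℤ.i≤pred[j]⇒i<j
      (≡.subst (_ ℤ.≤_) (ℤ.+-comm (+ t) ℤ.-1ℤ) (proj₂ (∈-interval⁻ {m} {+ t ℤ.- 1ℤ} (I⊆ x∈))))
  }

∈-index⁺ : ∀ {m t I} → IsState m t I → I ∈ subsets t (interval m (+ t ℤ.- 1ℤ))
∈-index⁺ {m} {t} {I} I-state = ≡.subst (λ k → I ∈ subsets k (interval m (+ t ℤ.- 1ℤ))) length≡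
  (∈-subsets⁺ (interval-sorted m (+ t ℤ.- 1ℤ)) sorted λ {x} x∈ → ∈-interval⁺ (lower x∈)
    (≡.subst (x ℤ.≤_) (ℤ.+-comm ℤ.-1ℤ (+ t)) (ℤ.i<j⇒i≤pred[j] (All.lookup upper x∈))))
  where open IsState I-state

module TransferExpansion (R : CommutativeRing c ℓ) (a b : ℤ) (ω : ℤ → CommutativeRing.Carrier R)
  (m : ℤ) (t : ℕ) (γ : ℤ → CommutativeRing.Carrier R) where
  open CommutativeRing R hiding (rawRing; zero)
  open Determinant R
  open Weighted (raw R) a b ω using (ε; module Transfer)
  open Transfer m (+ t) γ
  open Relation.Binary.Reasoning.Setoid setoid

  weight : List ℤ → ℕ → Carrier
  weight I p = sgn p * γ (column t I p)

  -- Rewriting the search for s as a sum over positions allows the sum over J to be exchanged with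
  -- the one over p. At most one term survives, because distinct positions have distinct next
  -- states.
  entry-expand : ∀ {I J} → IsState m t I → IsState m t J →
    entry I J ≈ sum {suc t} λ p → if does (next t I (toℕ p) ≟ᴸ J) then weight I (toℕ p) else 0#
  entry-expand {I} {J} I-state J-state with shift? (+ t) I J
  ... | yes (s , shift) with shift⇒next I-state J-state shift
  ...   | p , p≤t , ≡.refl , ≡.refl , count≡ = sym (trans
    (sum-single k λ q q≢k → reflexive (≡.cong (λ b → if b then weight I (toℕ q) else 0#)
      (dec-false (next t I (toℕ q) ≟ᴸ J) λ eq → q≢k (Fin.toℕ-injective (≡.trans
        (next-injective I-state (Fin.toℕ≤pred[n] q) p≤t eq) (≡.sym toℕ-k))))))
    (reflexive (≡.trans (≡.cong (λ q → if does (next t I q ≟ᴸ J) then weight I q else 0#) toℕ-k)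
      (≡.trans (≡.cong (λ b → if b then weight I p else 0#) (dec-true (next t I p ≟ᴸ J) ≡.refl))
        (≡.cong (λ q → sgn q * γ s) (≡.sym count≡))))))
    where
    k : Fin (suc t)
    k = fromℕ< (s≤s p≤t)
    toℕ-k : toℕ k ≡ p
    toℕ-k = Fin.toℕ-fromℕ< (s≤s p≤t)
  entry-expand {I} {J} I-state J-state | no ¬shift = sym (sum-zero {suc t} λ q →
    reflexive (≡.cong (λ b → if b then weight I (toℕ q) else 0#)
      (dec-false (next t I (toℕ q) ≟ᴸ J) λ { ≡.refl → ¬shift (_ , next⇒shift I-state (Fin.toℕ≤pred[n] q)) })))

  module _ (h : List ℤ → Carrier) (h≈0 : ∀ {J x} → length J ≡ t → x ∈ J → x ℤ.< m → h J ≈ 0#) where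

    -- If the next state has an element below m, both sides are zero by `h≈0`. Otherwise it is an
    -- index, and it occurs exactly once because the list of subsets has no repetitions.
    sum-index : ∀ {I p} w → IsState m t I → p ℕ.≤ t →
      sum (λ j → (if does (next t I p ≟ᴸ lookup index j) then w else 0#) * h (lookup index j)) ≈ w * h (next t I p)
    sum-index {I} {p} w I-state p≤t with any? (ℤ._<? m) (next t I p)
    ... | yes any = trans (sum-zero term≈0) (sym (trans (*-congˡ next≈0) (zeroʳ w)))
      where
      next≈0 : h (next t I p) ≈ 0#
      next≈0 = let x , x∈ , x<m = find any in h≈0 (next-length I-state p≤t) x∈ x<m
      term≈0 : ∀ j → (if does (next t I p ≟ᴸ lookup index j) then w else 0#) * h (lookup index j) ≈ 0#
      term≈0 j with next t I p ≟ᴸ lookup index j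
      ... | yes eq = trans (*-congˡ (trans (reflexive (≡.cong h (≡.sym eq))) next≈0)) (zeroʳ w)
      ... | no  _  = zeroˡ _
    ... | no ≮m = trans (sum-single k others) (*-cong
      (reflexive (≡.cong (λ b → if b then w else 0#) (dec-true (next t I p ≟ᴸ lookup index k) next≡)))
      (reflexive (≡.cong h (≡.sym next≡))))
      where
      next∈ : next t I p ∈ index
      next∈ = ∈-index⁺ (next-state I-state p≤t λ x∈ → ℤ.≮⇒≥ λ x<m → ≮m (lose x∈ x<m))
      k : Fin (length index)
      k = Any.index next∈
      next≡ : next t I p ≡ lookup index k
      next≡ = lookup-index next∈
      others : ∀ j → j ≢ k → (if does (next t I p ≟ᴸ lookup index j) then w else 0#) * h (lookup index j) ≈ 0#
      others j j≢k = trans (*-congʳ (reflexive (≡.cong (λ b → if b then w else 0#)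
        (dec-false (next t I p ≟ᴸ lookup index j) λ eq → j≢k
          (lookup-injective (subsets-unique t (interval-sorted m (+ t ℤ.- 1ℤ))) j k (≡.trans (≡.sym eq) next≡))))))
        (zeroˡ _)

    -- The right-hand side is what Laplace expansion produces from a first row with entries γ in the
    -- columns I, t, t + 1, ..., provided that γ vanishes beyond t.
    transfer-expand : ∀ i → let I = lookup index i in
      sum (λ j → matrix i j * h (lookup index j)) ≈ sum {suc t} λ p → weight I (toℕ p) * h (next t I (toℕ p))
    transfer-expand i = begin
      (sum λ j → matrix i j * h (lookup index j))
        ≈⟨ sum-cong-≋ (λ j → trans (*-congʳ {h (lookup index j)} (entry-expand I-state (∈-index⁻ (∈-lookup j))))
             (*-distribʳ-sum {suc t} (h (lookup index j)) (λ p → term p j))) ⟩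
      (sum λ j → sum {suc t} λ p → term p j * h (lookup index j))
        ≈⟨ ∑-comm (λ j (p : Fin (suc t)) → term p j * h (lookup index j)) ⟩
      (sum {suc t} λ p → sum λ j → term p j * h (lookup index j))
        ≈⟨ sum-cong-≋ {suc t} (λ p → sum-index (weight I (toℕ p)) I-state (Fin.toℕ≤pred[n] p)) ⟩
      (sum {suc t} λ p → weight I (toℕ p) * h (next t I (toℕ p))) ∎
      where
      I = lookup index i
      I-state : IsState m t I
      I-state = ∈-index⁻ (∈-lookup i)
      term : Fin (suc t) → Fin (length index) → Carrier
      term p j = if does (next t I (toℕ p) ≟ᴸ lookup index j) then weight I (toℕ p) else 0#

-- The banded determinants

toℕ-punchIn : ∀ {n} (i : Fin (suc n)) j → toℕ (punchIn i j) ≡ skip (toℕ i) (toℕ j)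
toℕ-punchIn zero    j       = ≡.refl
toℕ-punchIn (suc i) zero    = ≡.refl
toℕ-punchIn (suc i) (suc j) = ≡.cong suc (toℕ-punchIn i j)

skip-≤ : ∀ p s → skip p s ℕ.≤ suc s
skip-≤ zero    s       = ℕ.≤-refl
skip-≤ (suc p) zero    = z≤n
skip-≤ (suc p) (suc s) = s≤s (skip-≤ p s)

module NatIndexed (R : CommutativeRing c ℓ) where
  open CommutativeRing R hiding (rawRing; zero)
  open Determinant R

  -- Entries indexed by natural numbers let the size be rewritten along a propositional equality
  -- without casting the matrix.
  detℕ : ∀ n → (ℕ → ℕ → Carrier) → Carrier
  detℕ n M = det {n} λ i j → M (toℕ i) (toℕ j)

  detℕ-cong : ∀ n {M N : ℕ → ℕ → Carrier} → (∀ i j → i ℕ.< n → M i j ≈ N i j) → detℕ n M ≈ detℕ n N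
  detℕ-cong n M≈N = det-cong {n} λ i j → M≈N (toℕ i) (toℕ j) (Fin.toℕ<n i)

  sum-truncate : ∀ {t n} → t ℕ.≤ n → {f : ℕ → Carrier} → (∀ p → t ℕ.≤ p → f p ≈ 0#) →
    sum {n} (λ i → f (toℕ i)) ≈ sum {t} (λ i → f (toℕ i))
  sum-truncate {n = n} z≤n f≈0 = sum-zero {n} λ i → f≈0 (toℕ i) z≤n
  sum-truncate (s≤s t≤n) f≈0 = +-congˡ (sum-truncate t≤n λ p t≤p → f≈0 (suc p) (s≤s t≤p))

  detℕ-expandRow : ∀ {t n} → t ℕ.≤ n → (M : ℕ → ℕ → Carrier) → (∀ p → t ℕ.< p → M 0 p ≈ 0#) →
    detℕ (suc n) M ≈ sum {suc t} λ p → sgn (toℕ p) * M 0 (toℕ p) * detℕ n λ i j → M (suc i) (skip (toℕ p) j)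
  detℕ-expandRow {t} {n} t≤n M M≈0 = trans (det-expandRow {n} λ i j → M (toℕ i) (toℕ j)) (trans
    (sum-cong-≋ {suc n} λ p → trans (sym (*-assoc (sgn (toℕ p)) (M 0 (toℕ p)) _))
      (*-congˡ {sgn (toℕ p) * M 0 (toℕ p)} (det-cong {n} λ i j →
        reflexive (≡.cong (M (suc (toℕ i))) (toℕ-punchIn p j)))))
    (sum-truncate (s≤s t≤n) {λ p → sgn p * M 0 p * detℕ n λ i j → M (suc i) (skip p j)}
      λ p t<p → trans (*-congʳ (trans (*-congˡ (M≈0 p t<p)) (zeroʳ _))) (zeroˡ _)))

  detℕ-zeroColumn : ∀ {n} {M : ℕ → ℕ → Carrier} j → j ℕ.< n → (∀ i → i ℕ.< n → M i j ≈ 0#) → detℕ n M ≈ 0#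
  detℕ-zeroColumn {n} {M} j j<n M≈0 = det-zeroColumn {n} (fromℕ< j<n) λ i →
    trans (reflexive (≡.cong (M (toℕ i)) (Fin.toℕ-fromℕ< j<n))) (M≈0 (toℕ i) (Fin.toℕ<n i))

module _ (R : CommutativeRing c ℓ) (a : ℤ) where
  open CommutativeRing R using (Carrier; _≈_; 0#)

  record IsBanded (ω : ℤ → Carrier) : Set ℓ where
    field
      ω-> : ∀ {s} → a ℤ.< s → ω s ≈ 0#
      ω-< : ∀ {s} → s ℤ.< ℤ.- a → ω s ≈ 0#

  -- E x y stands for the summand ± ω y of 1 - A k, where y = k - j - i; it
  -- is absent unless x = k - 2 j is positive.
  record IsCorner (E : ℤ → ℤ → Carrier) : Set ℓ where
    field
      E-≤ : ∀ {x} y → x ℤ.≤ 0ℤ → E x y ≈ 0#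
      E-> : ∀ x {y} → a ℤ.< y → E x y ≈ 0#

module Recurrences (R : CommutativeRing c ℓ) (a′ : ℕ)
  (ω : ℤ → CommutativeRing.Carrier R) (banded : IsBanded R (+ suc a′) ω)
  (E : ℤ → ℤ → CommutativeRing.Carrier R) (corner : IsCorner R (+ suc a′) E)
  (n₀ n₁ : ℕ) (n₀≤1 : n₀ ℕ.≤ 1) (n₁≤1 : n₁ ℕ.≤ 1) where

  open CommutativeRing R hiding (rawRing; zero)
  open IsBanded banded
  open IsCorner corner
  open Algebra.Properties.Ring ring
  open Determinant R
  open NatIndexed R
  open Relation.Binary.Reasoning.Setoid setoid
  open Weighted (raw R) (+ suc a′) (+ suc a′) ω

  A : ℕ
  A = suc a′
  a : ℤ
  a = + A

  -- The number of rows of A k.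
  size : ℕ → ℕ
  size 0             = n₀
  size 1             = n₁
  size (suc (suc k)) = suc (size k)

  size-≤ : ∀ k → size k ℕ.≤ suc k
  size-≤ 0             = n₀≤1
  size-≤ 1             = ℕ.≤-trans n₁≤1 (s≤s z≤n)
  size-≤ (suc (suc k)) = s≤s (ℕ.m≤n⇒m≤1+n (size-≤ k))

  size-≥ : ∀ d k → d ℕ.+ d ℕ.≤ k → d ℕ.≤ size k
  size-≥ zero    k             _ = z≤n
  size-≥ (suc d) (suc k) (s≤s le) with k | ≡.subst (ℕ._≤ k) (ℕ.+-suc d d) le
  ... | suc k | s≤s le′ = s≤s (size-≥ d k le′)

  -- M k i c is the entry of 1 - A k in row i and column c.  All integers c
  -- are allowed, because the columns are renumbered after each step.
  M : ℕ → ℕ → ℤ → Carrier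
  M k i c = β (c ℤ.- + i) + E (+ k ℤ.- (c ℤ.+ c)) (+ k ℤ.- (c ℤ.+ + i))

  -- An entry depends only on c - i, k - 2 c and k - c - i. All three are invariant when i and c
  -- drop by 1 and k drops by 2; hence the factor z² in front of T.
  M-pred : ∀ k i c → M (2 ℕ.+ k) (suc i) c ≈ M k i (ℤ.pred c)
  M-pred k i c = reflexive (≡.cong₂ _+_ (≡.cong β diagonal) (≡.cong₂ E horizontal antidiagonal))
    where
    open +-*-Solver
    diagonal : c ℤ.- + suc i ≡ ℤ.pred c ℤ.- + i
    diagonal = solve 2 (λ c i → c :- (con 1ℤ :+ i) := (con ℤ.-1ℤ :+ c) :- i) ≡.refl c (+ i)
    horizontal : + (2 ℕ.+ k) ℤ.- (c ℤ.+ c) ≡ + k ℤ.- (ℤ.pred c ℤ.+ ℤ.pred c)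
    horizontal = solve 2 (λ k c → (con (+ 2) :+ k) :- (c :+ c) := k :- ((con ℤ.-1ℤ :+ c) :+ (con ℤ.-1ℤ :+ c))) ≡.refl (+ k) c
    antidiagonal : + (2 ℕ.+ k) ℤ.- (c ℤ.+ + suc i) ≡ + k ℤ.- (ℤ.pred c ℤ.+ + i)
    antidiagonal = solve 3 (λ k c i → (con (+ 2) :+ k) :- (c :+ (con 1ℤ :+ i)) := k :- ((con ℤ.-1ℤ :+ c) :+ i)) ≡.refl (+ k) c (+ i)

  β-ω : ∀ {s} → s ≢ 0ℤ → ω s ≈ 0# → β s ≈ 0#
  β-ω {s} s≢0 ω≈0 = trans (+-cong (reflexive (≡.cong (λ b → if b then 1# else 0#) (dec-false (s ℤ.≟ 0ℤ) s≢0)))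
    (trans (-‿cong ω≈0) -0#≈0#)) (+-identityˡ 0#)

  β-> : ∀ {s} → a ℤ.< s → β s ≈ 0#
  β-> a<s = β-ω (λ { ≡.refl → contradiction a<s λ { (ℤ.+<+ ()) } }) (ω-> a<s)

  β-< : ∀ {s} → s ℤ.< ℤ.- a → β s ≈ 0#
  β-< s<-a = β-ω (λ { ≡.refl → contradiction s<-a λ () }) (ω-< s<-a)

  M-top : ∀ k c → A ℕ.+ A ℕ.≤ k → M k 0 c ≈ β c
  M-top k c A+A≤k = trans (+-cong (reflexive (≡.cong β (ℤ.+-identityʳ c))) E≈0) (+-identityʳ (β c))
    where
    open +-*-Solver
    -- If k - c ≤ a, then k - 2 c ≤ 2 a - k ≤ 0.
    E≈0 : E (+ k ℤ.- (c ℤ.+ c)) (+ k ℤ.- (c ℤ.+ 0ℤ)) ≈ 0#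
    E≈0 with + k ℤ.- (c ℤ.+ 0ℤ) ℤ.≤? a
    ... | no  ≰a = E-> _ (ℤ.≰⇒> ≰a)
    ... | yes ≤a = E-≤ _ (≡.subst (ℤ._≤ 0ℤ)
      (solve 2 (λ k c → (k :- (c :+ con 0ℤ)) :+ (k :- (c :+ con 0ℤ)) :- k := k :- (c :+ c)) ≡.refl (+ k) c)
      (ℤ.i≤j⇒i-j≤0 (ℤ.≤-trans (ℤ.+-mono-≤ ≤a ≤a) (ℤ.+≤+ A+A≤k))))

  -- The Toeplitz index satisfies c - i ≤ c < -a, and the Hankel index satisfies k - c - i ≥ -c > a.
  -- The left bound of the band meets the right one here, which is where b = a matters.
  M-left : ∀ k i c → i ℕ.≤ k → c ℤ.< ℤ.- a → M k i c ≈ 0#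
  M-left k i c i≤k c<-a = trans (+-cong
    (β-< (ℤ.≤-<-trans (ℤ.i-j≤i c (+ i)) c<-a))
    (E-> _ (ℤ.<-≤-trans (≡.subst (ℤ._< ℤ.- c) (ℤ.neg-involutive a) (ℤ.neg-mono-< c<-a))
      (≡.subst (ℤ.- c ℤ.≤_) (solve 3 (λ c k i → :- c :+ (k :- i) := k :- (c :+ i)) ≡.refl c (+ k) (+ i))
        (≡.subst (ℤ._≤ ℤ.- c ℤ.+ (+ k ℤ.- + i)) (ℤ.+-identityʳ (ℤ.- c)) (ℤ.+-monoʳ-≤ (ℤ.- c) (ℤ.i≤j⇒0≤j-i (ℤ.+≤+ i≤k))))))))
    (+-identityˡ 0#)
    where open +-*-Solver

  f : List ℤ → ℕ → Carrier
  f I k = detℕ (size k) λ i j → M k i (column A I j)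

  -- Here row l is deleted, and the columns I, a - 1, a, … are shifted by 1,
  -- since column 0 is deleted.  G is a junk value unless l < size k.
  G g : List ℤ → ℕ → ℕ → Carrier
  G I k l = sgn l * detℕ (ℕ.pred (size k)) λ i j → M k (skip l i) (ℤ.suc (column a′ I j))
  g I k l = if does (l ℕ.<? size k) then G I k l else 0#

  -- The bound on k ensures at least a rows, so that every column of the state, in particular the
  -- zero column, really occurs in the determinant.
  f-vanish : ∀ k {J x} → A ℕ.+ A ℕ.≤ k → length J ≡ A → x ∈ J → x ℤ.< ℤ.- a → f J k ≈ 0#
  f-vanish k {J} {x} A+A≤k length≡ x∈J x<-a with column-∈ {A} x∈J
  ... | j , j< , ≡.refl = detℕ-zeroColumn j (ℕ.<-≤-trans (≡.subst (j ℕ.<_) length≡ j<) (size-≥ A k A+A≤k))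
    λ i i<n → M-left k i x (ℕ.≤-pred (ℕ.≤-trans i<n (size-≤ k))) x<-a

  f-step : ∀ k → A ℕ.+ A ℕ.≤ k → ∀ i →
    f (lookup T.index i) (2 ℕ.+ k) ≈ sum λ j → T.matrix i j * f (lookup T.index j) k
  f-step k A+A≤k i = begin
    f I (2 ℕ.+ k)
      ≈⟨ detℕ-expandRow (size-≥ A k A+A≤k) (λ i j → M (2 ℕ.+ k) i (column A I j)) top≈0 ⟩
    (sum {suc A} λ p → sgn (toℕ p) * M (2 ℕ.+ k) 0 (column A I (toℕ p)) *
        detℕ (size k) λ i j → M (2 ℕ.+ k) (suc i) (column A I (skip (toℕ p) j)))
      ≈⟨ sum-cong-≋ {suc A} (λ p → *-cong (*-congˡ {sgn (toℕ p)} (M-top (2 ℕ.+ k) (column A I (toℕ p)) A+A≤2+k))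
           (detℕ-cong (size k) λ i j _ → trans (M-pred k i (column A I (skip (toℕ p) j)))
             (reflexive (≡.cong (M k i) (≡.sym (column-next A I j
               (≡.subst (toℕ p ℕ.≤_) (≡.sym (IsState.length≡ I-state)) (Fin.toℕ≤pred[n] p)))))))) ⟩
    (sum {suc A} λ p → sgn (toℕ p) * β (column A I (toℕ p)) * f (next A I (toℕ p)) k)
      ≈⟨ transfer-expand (λ J → f J k) (f-vanish k A+A≤k) i ⟨
    (sum λ j → T.matrix i j * f (lookup T.index j) k) ∎
    where
    open TransferExpansion R (+ suc a′) (+ suc a′) ω (ℤ.- a) A β
    I = lookup T.index i
    I-state : IsState (ℤ.- a) A I
    I-state = ∈-index⁻ (∈-lookup i)
    A+A≤2+k : A ℕ.+ A ℕ.≤ 2 ℕ.+ k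
    A+A≤2+k = ℕ.m≤n⇒m≤1+n (ℕ.m≤n⇒m≤1+n A+A≤k)
    -- Position p = a holds the column a, still inside the band, so the expansion has a + 1 terms.
    top≈0 : ∀ p → A ℕ.< p → M (2 ℕ.+ k) 0 (column A I p) ≈ 0#
    top≈0 p A<p = trans (M-top (2 ℕ.+ k) (column A I p) A+A≤2+k)
      (trans (reflexive (≡.cong β (column-tail I-state (ℕ.<⇒≤ A<p)))) (β-> (ℤ.+<+ A<p)))

  size-suc : ∀ k → A ℕ.+ A ℕ.≤ k → ∃[ n ] size k ≡ suc n × a′ ℕ.≤ n
  size-suc k A+A≤k with size k | size-≥ A k A+A≤k
  ... | suc n | s≤s a′≤n = n , ≡.refl , a′≤n

  g-< : ∀ {l k n} I → size k ≡ suc n → l ℕ.≤ n →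
    g I k l ≈ sgn l * detℕ n (λ i j → M k (skip l i) (ℤ.suc (column a′ I j)))
  g-< {l} {k} {n} I size≡ l≤n = reflexive (≡.trans
    (≡.cong (λ b → if b then G I k l else 0#) (dec-true (l ℕ.<? size k) (≡.subst (l ℕ.<_) (≡.sym size≡) (s≤s l≤n))))
    (≡.cong (λ s → sgn l * detℕ (ℕ.pred s) (λ i j → M k (skip l i) (ℤ.suc (column a′ I j)))) size≡))

  g-≥ : ∀ {l k} I → size k ℕ.≤ l → g I k l ≈ 0#
  g-≥ {l} {k} I ≤l = reflexive (≡.cong (λ b → if b then G I k l else 0#) (dec-false (l ℕ.<? size k) (ℕ.≤⇒≯ ≤l)))

  -- Removing row 0 lowers the columns by 1, which cancels the shift caused by the missing column 0.
  -- The columns I, a - 1, a, ... that remain are those of the state I ∪ {a - 1}.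
  g-top : ∀ k I → g I (2 ℕ.+ k) 0 ≈ f (I ∷ʳ + a′) k
  g-top k I = trans (*-identityˡ _) (detℕ-cong (size k) λ i j _ → trans (M-pred k i (ℤ.suc (column a′ I j)))
    (reflexive (≡.cong (M k i) (≡.trans (ℤ.pred-suc _) (≡.sym (column-∷ʳ a′ I j))))))

  -- The columns of `g` are shifted up by 1, so the bound is -a - 1 instead of -a; this is the left
  -- end of the interval that indexes `T̃`.
  g-vanish : ∀ k l {J x} → A ℕ.+ A ℕ.≤ k → length J ≡ a′ → x ∈ J → x ℤ.< ℤ.- a ℤ.- 1ℤ → g J k l ≈ 0#
  g-vanish k l {J} {x} A+A≤k length≡ x∈J x<-a-1 with size-suc k A+A≤k | l ℕ.<? size k
  ... | _ | no l≮ = g-≥ J (ℕ.≮⇒≥ l≮)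
  ... | n , size≡ , a′≤n | yes l< with column-∈ {a′} x∈J
  ...   | j , j< , ≡.refl = trans (g-< J size≡ (ℕ.≤-pred (≡.subst (l ℕ.<_) size≡ l<))) (trans
    (*-congˡ (detℕ-zeroColumn j (ℕ.<-≤-trans (≡.subst (j ℕ.<_) length≡ j<) a′≤n) λ i i<n →
      M-left k (skip l i) (ℤ.suc x)
        (ℕ.≤-trans (skip-≤ l i) (ℕ.≤-trans i<n (ℕ.≤-pred (≡.subst (ℕ._≤ suc k) size≡ (size-≤ k)))))
        (≡.subst (ℤ.suc x ℤ.<_) (m+[x-m]≡x 1ℤ (ℤ.- a)) (ℤ.+-monoʳ-< 1ℤ x<-a-1))))
    (zeroʳ (sgn l)))

  -- Row 0 is not the deleted one, so the expansion along it applies. Both differences between β̃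
  -- and β arise here: the index s + 1 from the shift of the columns, and the minus sign from the
  -- cofactor sign, which changes between `suc l` and `l`.
  g-step : ∀ k → A ℕ.+ A ℕ.≤ k → ∀ l i →
    g (lookup T̃.index i) (2 ℕ.+ k) (suc l) ≈ sum λ j → T̃.matrix i j * g (lookup T̃.index j) k l
  g-step k A+A≤k l i with size-suc k A+A≤k | l ℕ.<? size k
  ... | _ | no l≮ = trans (g-≥ (lookup T̃.index i) (s≤s (ℕ.≮⇒≥ l≮)))
    (sym (sum-zero λ j → trans (*-congˡ {T̃.matrix i j} (g-≥ (lookup T̃.index j) (ℕ.≮⇒≥ l≮))) (zeroʳ _)))
  ... | n , size≡ , a′≤n | yes l< = begin
    g I (2 ℕ.+ k) (suc l)
      ≈⟨ g-< I (≡.cong suc size≡) (s≤s l≤n) ⟩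
    sgn (suc l) * detℕ (suc n) (λ i j → M (2 ℕ.+ k) (skip (suc l) i) (col j))
      ≈⟨ *-congˡ {sgn (suc l)} (detℕ-expandRow a′≤n (λ i j → M (2 ℕ.+ k) (skip (suc l) i) (col j)) top≈0) ⟩
    sgn (suc l) * (sum {suc a′} λ p → sgn (toℕ p) * M (2 ℕ.+ k) 0 (col (toℕ p)) *
        detℕ n λ i j → M (2 ℕ.+ k) (suc (skip l i)) (col (skip (toℕ p) j)))
      ≈⟨ *-distribˡ-sum {suc a′} (sgn (suc l)) (λ p → sgn (toℕ p) * M (2 ℕ.+ k) 0 (col (toℕ p)) *
        detℕ n λ i j → M (2 ℕ.+ k) (suc (skip l i)) (col (skip (toℕ p) j))) ⟩
    (sum {suc a′} λ p → sgn (suc l) * (sgn (toℕ p) * M (2 ℕ.+ k) 0 (col (toℕ p)) *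
        detℕ n λ i j → M (2 ℕ.+ k) (suc (skip l i)) (col (skip (toℕ p) j))))
      ≈⟨ sum-cong-≋ {suc a′} (λ p → trans (*-congˡ {sgn (suc l)} (*-cong (*-congˡ {sgn (toℕ p)} (M-top′ (toℕ p))) (minor≈ p)))
           (trans (move-sign (sgn l) (sgn (toℕ p)) (β (column a′ I (toℕ p) ℤ.+ 1ℤ)) _)
             (*-congˡ (sym (g-< (next a′ I (toℕ p)) size≡ l≤n))))) ⟩
    (sum {suc a′} λ p → sgn (toℕ p) * β̃ (column a′ I (toℕ p)) * g (next a′ I (toℕ p)) k l)
      ≈⟨ transfer-expand (λ J → g J k l) (g-vanish k l A+A≤k) i ⟨
    (sum λ j → T̃.matrix i j * g (lookup T̃.index j) k l) ∎
    where
    open TransferExpansion R (+ suc a′) (+ suc a′) ω (ℤ.- a ℤ.- 1ℤ) a′ β̃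
    I = lookup T̃.index i
    I-state : IsState (ℤ.- a ℤ.- 1ℤ) a′ I
    I-state = ∈-index⁻ (∈-lookup i)
    l≤n : l ℕ.≤ n
    l≤n = ℕ.≤-pred (≡.subst (l ℕ.<_) size≡ l<)
    A+A≤2+k : A ℕ.+ A ℕ.≤ 2 ℕ.+ k
    A+A≤2+k = ℕ.m≤n⇒m≤1+n (ℕ.m≤n⇒m≤1+n A+A≤k)
    col : ℕ → ℤ
    col p = ℤ.suc (column a′ I p)
    M-top′ : ∀ p → M (2 ℕ.+ k) 0 (col p) ≈ β (column a′ I p ℤ.+ 1ℤ)
    M-top′ p = trans (M-top (2 ℕ.+ k) (col p) A+A≤2+k) (reflexive (≡.cong β (ℤ.+-comm 1ℤ (column a′ I p))))
    top≈0 : ∀ p → a′ ℕ.< p → M (2 ℕ.+ k) 0 (col p) ≈ 0#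
    top≈0 p a′<p = trans (M-top (2 ℕ.+ k) (col p) A+A≤2+k)
      (trans (reflexive (≡.cong (λ x → β (ℤ.suc x)) (column-tail I-state (ℕ.<⇒≤ a′<p)))) (β-> (ℤ.+<+ (s≤s a′<p))))
    minor≈ : (p : Fin (suc a′)) → detℕ n (λ i j → M (2 ℕ.+ k) (suc (skip l i)) (col (skip (toℕ p) j))) ≈
      detℕ n (λ i j → M k (skip l i) (ℤ.suc (column a′ (next a′ I (toℕ p)) j)))
    minor≈ p = detℕ-cong n λ i j _ → let c = column a′ I (skip (toℕ p) j) in trans (M-pred k (skip l i) (col (skip (toℕ p) j)))
      (reflexive (≡.cong (M k (skip l i)) (≡.trans (ℤ.pred-suc c) (≡.trans (≡.sym (ℤ.suc-pred c)) (≡.cong ℤ.suc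
        (≡.sym (column-next a′ I j (≡.subst (toℕ p ℕ.≤_) (≡.sym (IsState.length≡ I-state)) (Fin.toℕ≤pred[n] p)))))))))
    move-sign : ∀ s q x d → - 1# * s * (q * x * d) ≈ q * - x * (s * d)
    move-sign s q x d = begin
      - 1# * s * (q * x * d)    ≈⟨ rearrange (- 1#) s q x d ⟩
      q * (- 1# * x) * (s * d)  ≈⟨ *-congʳ (*-congˡ (-1*x≈-x x)) ⟩
      q * - x * (s * d)         ∎
      where
      open *-Solver using (_⊕_; _⊜_)
      rearrange : ∀ m s q x d → m * s * (q * x * d) ≈ q * (m * x) * (s * d)
      rearrange = *-Solver.solve 5 (λ m s q x d → ((m ⊕ s) ⊕ ((q ⊕ x) ⊕ d)) ⊜ ((q ⊕ (m ⊕ x)) ⊕ (s ⊕ d))) refl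

-- Their generating functions

module Resolvent (R : CommutativeRing c ℓ) (P : Subring R ℓ′) where
  open CommutativeRing R hiding (rawRing; zero)
  open Algebra.Properties.Ring ring
  open Determinant R
  open PowerSeriesRing R
  open Subring P
  module Poly = Subring (polynomials P)

  constant : Carrier → S
  constant = const (raw R)

  constant-∈ : ∀ {x} → Member x → Poly.Member (constant x)
  constant-∈ x∈ = (1 , λ { (suc k) _ → refl }) , λ { zero → x∈ ; (suc k) → 0∈ }

  z-∈ : Poly.Member z
  z-∈ = (2 , λ { (suc (suc k)) _ → refl ; (suc zero) (s≤s ()) }) ,
    λ { zero → 0∈ ; (suc zero) → 1∈ ; (suc (suc k)) → 0∈ }

  z²-∈ : Poly.Member z²
  z²-∈ = Poly.*-∈ z-∈ z-∈

  ⋆-coefficient-∈ : ∀ {f g : S} → (∀ k → Member (f k)) → (∀ k → Member (g k)) → ∀ k → Member ((f ⋆ g) k)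
  ⋆-coefficient-∈ f∈ g∈ k = sum-∈ P {suc k} λ i → *-∈ (f∈ (toℕ i)) (g∈ (k ℕ.∸ toℕ i))

  series-sum-coefficient : ∀ {n} (t : Fin n → Carrier) (Φ : Fin n → S) k →
    D⟦⟧.sum (λ j → constant (t j) ⋆ Φ j) k ≈ sum (λ j → t j * Φ j k)
  series-sum-coefficient t Φ k = trans (sum-coeff (λ j → constant (t j) ⋆ Φ j) k)
    (sum-cong-≋ λ j → ⋆-const (t j) (Φ j) k)

  module _ {n} (t : Matrix n) (t∈ : ∀ i j → Member (t i j)) (Φ : Fin n → S) (Φ∈ : ∀ i k → Member (Φ i k))
    (d : ℕ) (step : ∀ k → d ℕ.≤ k → ∀ i → Φ i (2 ℕ.+ k) ≈ sum λ j → t i j * Φ j k) where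

    private
      total : Fin n → S
      total i = D⟦⟧.sum λ j → constant (t i j) ⋆ Φ j

      total-coefficient : ∀ i k → total i k ≈ sum λ j → t i j * Φ j k
      total-coefficient i = series-sum-coefficient (t i) Φ

      remainder-∈ : ∀ i → Poly.Member (λ k → Φ i k + - (z² ⋆ total i) k)
      remainder-∈ i = (2 ℕ.+ d , vanish) ,
        λ k → +-∈ (Φ∈ i k) (-‿∈ (⋆-coefficient-∈ (proj₂ z²-∈) total-∈ k))
        where
        total-∈ : ∀ k → Member (total i k)
        total-∈ k = resp (sym (total-coefficient i k)) (sum-∈ P λ j → *-∈ (t∈ i j) (Φ∈ j k))
        vanish : ∀ k → 2 ℕ.+ d ℕ.≤ k → Φ i k + - (z² ⋆ total i) k ≈ 0#
        vanish (suc (suc k)) (s≤s (s≤s d≤k)) = trans (+-cong (step k d≤k i)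
          (-‿cong (trans (z²⋆-suc (total i) k) (total-coefficient i k)))) (-‿inverseʳ _)

    -- The recurrence makes the coefficients of (1 - z² t) Φ vanish from order d + 2 on, so this
    -- vector is polynomial and `det-clear` applies with `y` equal to 1.
    det⋆-∈ : ∀ i → Poly.Member (D⟦⟧.det (D⟦⟧._∸_ D⟦⟧.𝟙 λ i j → z² ⋆ constant (t i j)) ⋆ Φ i)
    det⋆-∈ i = Poly.resp (⋆-cong {D} {D} {R⟦⟧.1# ⋆ Φ i} {Φ i} (λ _ → refl) (R⟦⟧.*-identityˡ (Φ i)))
      (D⟦⟧.det-clear (polynomials P) (λ i j → constant (t i j)) z² R⟦⟧.1# Φ (λ i j → constant-∈ (t∈ i j)) z²-∈
        (λ i → Poly.resp (λ k → sym (R⟦⟧.*-identityˡ (λ k → Φ i k + - (z² ⋆ total i) k) k)) (remainder-∈ i)) i)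
      where
      D : S
      D = D⟦⟧.det (D⟦⟧._∸_ D⟦⟧.𝟙 λ i j → z² ⋆ constant (t i j))

  -- At order 0 the matrix is the identity. The denominators therefore have constant term 1 and are
  -- invertible series.
  det-head≈1 : ∀ {n} (x : S) → x 0 ≈ 0# → (t : Fin n → Fin n → S) →
    D⟦⟧.det (D⟦⟧._∸_ D⟦⟧.𝟙 λ i j → x ⋆ t i j) 0 ≈ 1#
  det-head≈1 {n} x x₀≈0 t = trans (det-head (D⟦⟧._∸_ D⟦⟧.𝟙 λ i j → x ⋆ t i j)) (trans (det-cong entry≈) (det-𝟙 n))
    where
    entry≈ : ∀ i j → D⟦⟧.𝟙 i j 0 + - (x ⋆ t i j) 0 ≈ 𝟙 i j
    entry≈ i j = trans (+-cong (𝟙-head i j)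
      (trans (-‿cong (trans (⋆-head x (t i j)) (trans (*-congʳ x₀≈0) (zeroˡ _)))) -0#≈0#)) (+-identityʳ _)
      where
      𝟙-head : ∀ i j → D⟦⟧.𝟙 {n} i j 0 ≈ 𝟙 i j
      𝟙-head i j with does (i Fin.≟ j)
      ... | true  = refl
      ... | false = refl

-- A polynomial in z over K[u] comes with a separate u-degree bound for each coefficient, whereas
-- `IsPolynomial₂` asks for a single bound.
uniform-bound : ∀ e (d : ℕ → ℕ) → ∃[ m ] (∀ k → k ℕ.< e → d k ℕ.≤ m)
uniform-bound zero    d = 0 , λ _ ()
uniform-bound (suc e) d = let m , d≤m = uniform-bound e (λ k → d (suc k)) in
  d 0 ℕ.+ m , λ { zero _ → ℕ.m≤m+n (d 0) m ; (suc k) (s≤s k<e) → ℕ.≤-trans (d≤m k k<e) (ℕ.m≤n+m m (d 0)) }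

module _ (R : CommutativeRing c ℓ) where
  open CommutativeRing R hiding (rawRing)
  open PowerSeries (raw R)
  open PowerSeriesRing using (polynomials; full)
  private
    P₂ = polynomials _ (polynomials R (full R))

  isPolynomial₂ : ∀ {f} → Subring.Member P₂ f → IsPolynomial₂ f
  isPolynomial₂ {f} ((e , f≈0) , f∈) = let m , d≤m = uniform-bound e d in
    e ℕ.+ m , λ where
      k l (inj₁ e+m≤k) → f≈0 k (ℕ.m+n≤o⇒m≤o e e+m≤k) l
      k l (inj₂ e+m≤l) → by-cases k l (λ k<e → ℕ.≤-trans (d≤m k k<e) (ℕ.m+n≤o⇒n≤o e e+m≤l)) (k ℕ.<? e)
    where
    d : ℕ → ℕ
    d k = proj₁ (proj₁ (f∈ k))
    by-cases : ∀ k l → (k ℕ.< e → d k ℕ.≤ l) → Dec (k ℕ.< e) → f k l ≈ 0#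
    by-cases k l d≤l (yes k<e) = proj₂ (proj₁ (f∈ k)) l (d≤l k<e)
    by-cases k l d≤l (no k≮e)  = f≈0 k (ℕ.≮⇒≥ k≮e) l

module Generating (R : CommutativeRing c ℓ) (a′ : ℕ)
  (ω : ℤ → CommutativeRing.Carrier R) (banded : IsBanded R (+ suc a′) ω)
  (E : ℤ → ℤ → CommutativeRing.Carrier R) (corner : IsCorner R (+ suc a′) E)
  (n₀ n₁ : ℕ) (n₀≤1 : n₀ ℕ.≤ 1) (n₁≤1 : n₁ ℕ.≤ 1) where

  open CommutativeRing R hiding (rawRing; zero)
  open Algebra.Properties.Ring ring
  open Determinant R hiding (_∸_)
  open Recurrences R a′ ω banded E corner n₀ n₁ n₀≤1 n₁≤1
  open Weighted (raw R) (+ suc a′) (+ suc a′) ω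
  open PowerSeries (raw R)
  module K = PowerSeriesRing R
  module Ku = PowerSeriesRing K.ring⟦⟧
  P₂ = K.polynomials K.full
  module R₁ = Resolvent R K.full
  module R₂ = Resolvent K.ring⟦⟧ P₂
  module Poly₁ = Subring (K.polynomials K.full)
  module Poly₂ = Subring (Ku.polynomials P₂)

  D₁ : K.S
  D₁ = D K⟦z⟧ ι₁ (z₁ ·₁ z₁)

  D₂ D̃₂ x₂ : Ku.S
  D₂ = D K⟦u,z⟧ ι₂ (z₂ ·₂ z₂)
  x₂ = u₂ ·₂ (z₂ ·₂ z₂)
  D̃₂ = D̃ K⟦u,z⟧ ι₂ x₂

  -- From these states the columns are 0, 1, 2, ... for `f` and, after the shift by 1, 1, 2, 3, ...
  -- for `g`: those of 1 - A_k and of its minors without column 0.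
  I₀ : List ℤ
  I₀ = range 0 A
  Ĩ₀ : List ℤ
  Ĩ₀ = range 0 a′

  range-state : ∀ {m n} → m ℤ.≤ 0ℤ → IsState m n (range 0 n)
  range-state {m} {n} m≤0 = record
    { length≡ = length-range 0 n
    ; sorted  = range-sorted 0 n
    ; lower   = λ x∈ → ℤ.≤-trans m≤0 (proj₁ (All.lookup (range-bounds 0 n) x∈))
    ; upper   = All.map proj₂ (range-bounds 0 n)
    }

  module _ {J} (J-state : IsState (ℤ.- a) A J) where
    private
      J∈ : J ∈ T.index
      J∈ = ∈-index⁺ J-state

    f-series : Poly₁.Member (D₁ ·₁ f J)
    f-series = ≡.subst (λ I → Poly₁.Member (D₁ ·₁ f I)) (≡.sym (lookup-index J∈))
      (R₁.det⋆-∈ T.matrix (λ _ _ → _) (λ i → f (lookup T.index i)) (λ _ _ → _) (A ℕ.+ A) f-step (Any.index J∈))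

    -- The recurrence is run again over K[[u]], which spares a proof that `D` commutes with the
    -- embedding of K[[z]].
    f-series₂ : Poly₂.Member (D₂ ·₂ (λ k → ι₁ (f J k)))
    f-series₂ = ≡.subst (λ I → Poly₂.Member (D₂ ·₂ (λ k → ι₁ (f I k)))) (≡.sym (lookup-index J∈))
      (R₂.det⋆-∈ (λ i j → ι₁ (T.matrix i j)) (λ i j → R₁.constant-∈ _) (λ i k → ι₁ (f (lookup T.index i) k))
        (λ i k → R₁.constant-∈ _) (A ℕ.+ A) step (Any.index J∈))
      where
      step : ∀ k → A ℕ.+ A ℕ.≤ k → ∀ i l →
        ι₁ (f (lookup T.index i) (2 ℕ.+ k)) l ≈ K.D⟦⟧.sum (λ j → ι₁ (T.matrix i j) ·₁ ι₁ (f (lookup T.index j) k)) l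
      step k A+A≤k i l = trans (lhs l) (sym (R₁.series-sum-coefficient (T.matrix i) (λ j → ι₁ (f (lookup T.index j) k)) l))
        where
        lhs : ∀ l → ι₁ (f (lookup T.index i) (2 ℕ.+ k)) l ≈ sum λ j → T.matrix i j * ι₁ (f (lookup T.index j) k) l
        lhs zero    = f-step k A+A≤k i
        lhs (suc l) = sym (sum-zero λ j → zeroʳ (T.matrix i j))

  D₁-∈ : Poly₁.Member D₁
  D₁-∈ = K.D⟦⟧.det[𝟙∸]-∈ (K.polynomials K.full) (λ i j → ι₁ (T.matrix i j)) (λ i j → R₁.constant-∈ _) R₁.z²-∈

  D₂-∈ : Poly₂.Member D₂
  D₂-∈ = Ku.D⟦⟧.det[𝟙∸]-∈ (Ku.polynomials P₂) (λ i j → ι₂ (T.matrix i j))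
    (λ i j → R₂.constant-∈ (R₁.constant-∈ _)) R₂.z²-∈

  x₂-∈ : Poly₂.Member x₂
  x₂-∈ = Poly₂.*-∈ (R₂.constant-∈ R₁.z-∈) R₂.z²-∈

  module _ {I} (I-state : IsState (ℤ.- a ℤ.- 1ℤ) a′ I) where
    private
      J : List ℤ
      J = I ∷ʳ + a′

      J-length : length J ≡ A
      J-length = ≡.trans (length-∷ʳ I (+ a′)) (≡.cong suc (IsState.length≡ I-state))

      J-state : (∀ {x} → x ∈ J → ℤ.- a ℤ.≤ x) → IsState (ℤ.- a) A J
      J-state lower = record
        { length≡ = J-length
        ; sorted  = sorted-∷ʳ (IsState.sorted I-state) (IsState.upper I-state)
        ; lower   = lower
        ; upper   = All.∷ʳ⁺ (All.map (λ x< → ℤ.<-trans x< (ℤ.+<+ ℕ.≤-refl)) (IsState.upper I-state)) (ℤ.+<+ ℕ.≤-refl)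
        }

    -- The interval for I reaches one further to the left than the one for `T`, so J need not index
    -- `T`. If it does not, `f J k` is 0 for k ≥ 2a, and the series is already a polynomial.
    f-series₂-∷ʳ : Poly₂.Member (D₂ ·₂ (λ k → ι₁ (f J k)))
    f-series₂-∷ʳ = by-cases (any? (ℤ._<? ℤ.- a) J)
      where
      polynomial : ∀ {x} → x ∈ J → x ℤ.< ℤ.- a → Poly₂.Member (λ k → ι₁ (f J k))
      polynomial x∈ x<-a = (A ℕ.+ A , λ { k A+A≤k zero → f-vanish k A+A≤k J-length x∈ x<-a ; k _ (suc l) → refl }) ,
        λ k → R₁.constant-∈ _
      by-cases : Dec (Any (ℤ._< ℤ.- a) J) → Poly₂.Member (D₂ ·₂ (λ k → ι₁ (f J k)))
      by-cases (no ≮-a)  = f-series₂ (J-state λ x∈ → ℤ.≮⇒≥ λ x<-a → ≮-a (lose x∈ x<-a))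
      by-cases (yes any) = let x , x∈ , x<-a = find any in
        Poly₂.*-∈ {D₂} {λ k → ι₁ (f J k)} D₂-∈ (polynomial x∈ x<-a)

  private
    Γ Ψ total : Fin (length T̃.index) → Ku.S
    Γ i = g (lookup T̃.index i)
    Ψ i k = ι₁ (f (lookup T̃.index i ∷ʳ + a′) k)
    total i = Ku.D⟦⟧.sum λ j → ι₂ (T̃.matrix i j) ·₂ Γ j

    -- The value 0 of `g` outside the index range makes every coefficient of z^k a polynomial in u.
    Γ-∈ : ∀ i k → Subring.Member P₂ (Γ i k)
    Γ-∈ i k = (size k , λ l → g-≥ (lookup T̃.index i)) , λ _ → _

    total-coefficient : ∀ i k l → total i k l ≈ sum λ j → T̃.matrix i j * Γ j k l
    total-coefficient i k l = trans (R₂.series-sum-coefficient (λ j → ι₁ (T̃.matrix i j)) Γ k l)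
      (R₁.series-sum-coefficient (T̃.matrix i) (λ j → Γ j k) l)

    total-∈ : ∀ i k → Subring.Member P₂ (total i k)
    total-∈ i k = Subring.resp P₂ (λ l → sym (R₂.series-sum-coefficient (λ j → ι₁ (T̃.matrix i j)) Γ k l))
      (K.D⟦⟧.sum-∈ P₂ λ j → Subring.*-∈ P₂ (R₁.constant-∈ _) (Γ-∈ j k))

    x₂-coefficient : ∀ (h : Ku.S) k l → (x₂ ·₂ h) (2 ℕ.+ k) l ≈ (z₁ ·₁ h k) l
    x₂-coefficient h k l = trans (Ku.⋆-assoc u₂ Ku.z² h (2 ℕ.+ k) l) (trans (Ku.⋆-const z₁ (Ku.z² ·₂ h) (2 ℕ.+ k) l)
      (K.⋆-cong {z₁} {z₁} (λ _ → refl) (Ku.z²⋆-suc h k) l))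

    -- Γ - u z² T̃ Γ - z² Ψ, a polynomial: beyond the first orders in z, the coefficients of u^0
    -- cancel by `g-top` and those of higher powers of u by `g-step`.
    remainder : Fin (length T̃.index) → Ku.S
    remainder i k l = (Γ i k l + - (x₂ ·₂ total i) k l) + - (z₂ ·₂ z₂ ·₂ Ψ i) k l

    remainder-∈ : ∀ i → Poly₂.Member (remainder i)
    remainder-∈ i = (2 ℕ.+ (A ℕ.+ A) , vanish) , λ k → P₂.+-∈
      (P₂.+-∈ (Γ-∈ i k) (P₂.-‿∈ (R₂.⋆-coefficient-∈ {x₂} {total i} (proj₂ x₂-∈) (total-∈ i) k)))
      (P₂.-‿∈ (R₂.⋆-coefficient-∈ {z₂ ·₂ z₂} {Ψ i} (proj₂ R₂.z²-∈) (λ k → R₁.constant-∈ _) k))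
      where
      module P₂ = Subring P₂
      vanish : ∀ k → 2 ℕ.+ (A ℕ.+ A) ℕ.≤ k → ∀ l → remainder i k l ≈ 0#
      vanish (suc (suc k)) (s≤s (s≤s A+A≤k)) l = trans
        (+-cong (+-congˡ (-‿cong (x₂-coefficient (total i) k l))) (-‿cong (Ku.z²⋆-suc (Ψ i) k l))) (cancel l)
        where
        cancel : ∀ l → (Γ i (2 ℕ.+ k) l + - (z₁ ·₁ total i k) l) + - Ψ i k l ≈ 0#
        cancel zero = trans (+-congʳ (trans (+-cong (g-top k (lookup T̃.index i))
          (trans (-‿cong (K.z⋆-zero (total i k))) -0#≈0#)) (+-identityʳ _))) (-‿inverseʳ _)
        cancel (suc l) = trans (+-cong (trans (+-cong (g-step k A+A≤k l i)
          (-‿cong (trans (K.z⋆-suc (total i k) l) (total-coefficient i k l)))) (-‿inverseʳ _)) -0#≈0#) (+-identityʳ 0#)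

    -- The vector (1 - u z² T̃) Γ is the polynomial remainder plus z² Ψ, and D(z²) clears the
    -- denominator of Ψ.
    split : ∀ i → Poly₂.Member (D₂ ·₂ (λ k l → Γ i k l + - (x₂ ·₂ total i) k l))
    split i = Poly₂.resp eq (Poly₂.+-∈ (Poly₂.*-∈ D₂-∈ (remainder-∈ i))
      (Poly₂.*-∈ R₂.z²-∈ (f-series₂-∷ʳ (∈-index⁻ (∈-lookup i)))))
      where
      open CommutativeRing Ku.ring⟦⟧ using () renaming (_≈_ to _≈₂_; _+_ to _+₂_; -_ to -₂_; setoid to setoid₂)
      module B = CommutativeRing Ku.ring⟦⟧
      X Y : Ku.S
      X k l = Γ i k l + - (x₂ ·₂ total i) k l
      Y = z₂ ·₂ z₂ ·₂ Ψ i
      eq : (D₂ ·₂ remainder i) +₂ (z₂ ·₂ z₂ ·₂ (D₂ ·₂ Ψ i)) ≈₂ D₂ ·₂ X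
      eq = begin
        (D₂ ·₂ (X +₂ (-₂ Y))) +₂ (z₂ ·₂ z₂ ·₂ (D₂ ·₂ Ψ i))
          ≈⟨ B.+-congˡ {D₂ ·₂ (X +₂ (-₂ Y))} exchange ⟩
        (D₂ ·₂ (X +₂ (-₂ Y))) +₂ (D₂ ·₂ Y)
          ≈⟨ B.distribˡ D₂ (X +₂ (-₂ Y)) Y ⟨
        D₂ ·₂ ((X +₂ (-₂ Y)) +₂ Y)
          ≈⟨ B.*-congˡ {D₂} (λ k l → trans (+-assoc _ _ _) (trans (+-congˡ (-‿inverseˡ _)) (+-identityʳ _))) ⟩
        D₂ ·₂ X ∎
        where
        open Relation.Binary.Reasoning.Setoid setoid₂
        exchange : z₂ ·₂ z₂ ·₂ (D₂ ·₂ Ψ i) ≈₂ D₂ ·₂ Y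
        exchange = B.trans (B.sym (B.*-assoc (z₂ ·₂ z₂) D₂ (Ψ i)))
          (B.trans (B.*-congʳ {Ψ i} (B.*-comm (z₂ ·₂ z₂) D₂)) (B.*-assoc D₂ (z₂ ·₂ z₂) (Ψ i)))

  g-series : ∀ {J} → IsState (ℤ.- a ℤ.- 1ℤ) a′ J → Poly₂.Member (D̃₂ ·₂ (D₂ ·₂ g J))
  g-series {J} J-state = ≡.subst (λ I → Poly₂.Member (D̃₂ ·₂ (D₂ ·₂ g I))) (≡.sym (lookup-index J∈))
    (Ku.D⟦⟧.det-clear (Ku.polynomials P₂) (λ i j → ι₂ (T̃.matrix i j)) x₂ D₂ Γ
      (λ i j → R₂.constant-∈ (R₁.constant-∈ _)) x₂-∈ split (Any.index J∈))
    where
    J∈ : J ∈ T̃.index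
    J∈ = ∈-index⁺ J-state

  invertible₁ : Algebra.Definitions.Invertible (RawRing._≈_ K⟦z⟧) (RawRing.1# K⟦z⟧) _·₁_ D₁
  invertible₁ = K.invertible D₁ (R₁.det-head≈1 K.z² (K.z⋆-zero z₁) (λ i j → ι₁ (T.matrix i j)))

  invertible₂ : Algebra.Definitions.Invertible (RawRing._≈_ K⟦u,z⟧) (RawRing.1# K⟦u,z⟧) _·₂_ (D̃₂ ·₂ D₂)
  invertible₂ = Ku.invertible (D̃₂ ·₂ D₂) λ l → trans (Ku.⋆-head D̃₂ D₂ l) (trans
    (K.⋆-cong {D̃₂ 0} {K.R⟦⟧.1#} {D₂ 0} {K.R⟦⟧.1#}
      (R₂.det-head≈1 x₂ x₂-head (λ i j → ι₂ (T̃.matrix i j)))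
      (R₂.det-head≈1 Ku.z² (Ku.z⋆-zero z₂) (λ i j → ι₂ (T.matrix i j))) l)
    (K.R⟦⟧.*-identityˡ K.R⟦⟧.1# l))
    where
    x₂-head : ∀ l → x₂ 0 l ≈ 0#
    x₂-head l = trans (Ku.⋆-const z₁ Ku.z² 0 l) (trans (K.⋆-cong {z₁} {z₁} (λ _ → refl) (Ku.z⋆-zero z₂) l) (K.R⟦⟧.zeroʳ z₁ l))

  -- The generating functions as quotients

  module _ (F : ℕ → Carrier) (F₀≈1 : F 0 ≈ 1#) (F≈f : ∀ k → F (suc k) ≈ f I₀ k) where

    quotient₁ : ∃[ N ] IsPolynomial N × IsQuotient K⟦z⟧ F N D₁
    -- The numerator is the product itself; the content is that it is a polynomial.
    quotient₁ = F ·₁ D₁ , proj₁ FD-∈ , invertible₁ , λ _ → refl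
      where
      module B = CommutativeRing K.ring⟦⟧
      -- `F` at k + 1 belongs to the matrix with index k, hence the factor z and the separate
      -- constant term.
      F≈ : F B.≈ (B.1# B.+ z₁ ·₁ f I₀)
      F≈ zero    = trans F₀≈1 (sym (trans (+-congˡ (K.z⋆-zero (f I₀))) (+-identityʳ 1#)))
      F≈ (suc k) = trans (F≈f k) (sym (trans (+-congˡ (K.z⋆-suc (f I₀) k)) (+-identityˡ _)))
      FD≈ : D₁ B.+ z₁ ·₁ (D₁ ·₁ f I₀) B.≈ F ·₁ D₁
      FD≈ = begin
        D₁ B.+ z₁ ·₁ (D₁ ·₁ f I₀)           ≈⟨ B.+-cong (B.sym (B.*-identityˡ D₁))
                                                (B.*-congˡ {z₁} (B.*-comm D₁ (f I₀))) ⟩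
        B.1# ·₁ D₁ B.+ z₁ ·₁ (f I₀ ·₁ D₁)   ≈⟨ B.+-congˡ {B.1# ·₁ D₁} (B.*-assoc z₁ (f I₀) D₁) ⟨
        B.1# ·₁ D₁ B.+ z₁ ·₁ f I₀ ·₁ D₁     ≈⟨ B.distribʳ D₁ B.1# (z₁ ·₁ f I₀) ⟨
        (B.1# B.+ z₁ ·₁ f I₀) ·₁ D₁         ≈⟨ B.*-congʳ {D₁} F≈ ⟨
        F ·₁ D₁                             ∎
        where open Relation.Binary.Reasoning.Setoid B.setoid
      FD-∈ : Poly₁.Member (F ·₁ D₁)
      FD-∈ = Poly₁.resp {D₁ B.+ z₁ ·₁ (D₁ ·₁ f I₀)} {F ·₁ D₁} FD≈
        (Poly₁.+-∈ {D₁} {z₁ ·₁ (D₁ ·₁ f I₀)} D₁-∈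
          (Poly₁.*-∈ {z₁} {D₁ ·₁ f I₀} R₁.z-∈ (f-series (range-state (ℤ.neg-≤-pos {A} {0})))))

  module _ (F : ℕ → ℕ → Carrier) (F≈g : ∀ k l → F k l ≈ g Ĩ₀ k l) where

    quotient₂ : ∃[ N ] IsPolynomial₂ N × IsQuotient K⟦u,z⟧ F N (D̃₂ ·₂ D₂)
    quotient₂ = F ·₂ (D̃₂ ·₂ D₂) , isPolynomial₂ R FD-∈ , invertible₂ , λ _ _ → refl
      where
      module B = CommutativeRing Ku.ring⟦⟧
      FD≈ : D̃₂ ·₂ (D₂ ·₂ g Ĩ₀) B.≈ F ·₂ (D̃₂ ·₂ D₂)
      FD≈ = begin
        D̃₂ ·₂ (D₂ ·₂ g Ĩ₀)   ≈⟨ B.*-assoc D̃₂ D₂ (g Ĩ₀) ⟨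
        D̃₂ ·₂ D₂ ·₂ g Ĩ₀     ≈⟨ B.*-comm (D̃₂ ·₂ D₂) (g Ĩ₀) ⟩
        g Ĩ₀ ·₂ (D̃₂ ·₂ D₂)   ≈⟨ B.*-congʳ {D̃₂ ·₂ D₂} F≈g ⟨
        F ·₂ (D̃₂ ·₂ D₂)      ∎
        where open Relation.Binary.Reasoning.Setoid B.setoid
      FD-∈ : Poly₂.Member (F ·₂ (D̃₂ ·₂ D₂))
      FD-∈ = Poly₂.resp {D̃₂ ·₂ (D₂ ·₂ g Ĩ₀)} {F ·₂ (D̃₂ ·₂ D₂)} FD≈
        (g-series (range-state (ℤ.≤-trans (ℤ.i-j≤i (ℤ.- a) 1ℤ) (ℤ.neg-≤-pos {A} {0}))))

  module _ (n : ℕ → ℕ) (size≡n : ∀ k → size k ≡ n k) (N : ∀ k → Matrix (n k))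
    (N≈M : ∀ k i j → N k i j ≈ M k (toℕ i) (+ toℕ j)) where
    open NatIndexed R

    det≈f : ∀ k → det (N k) ≈ f I₀ k
    det≈f k = trans (det-cong λ i j → trans (N≈M k i j) (reflexive (≡.cong (M k (toℕ i)) (≡.sym (column-range 0 A (toℕ j))))))
      (reflexive (≡.cong (λ s → detℕ s λ i j → M k i (column A I₀ j)) (≡.sym (size≡n k))))

    cofactor≈g : ∀ k l (l< : l ℕ.< n k) → cofactor (N k) (fromℕ< l<) ≈ g Ĩ₀ k l
    cofactor≈g k l l< = trans (general (n k) (N k) (N≈M k) l<) (sym (reflexive (≡.trans
      (≡.cong (λ b → if b then G Ĩ₀ k l else 0#) (dec-true (l ℕ.<? size k) (≡.subst (l ℕ.<_) (≡.sym (size≡n k)) l<)))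
      (≡.cong (λ s → sgn l * detℕ (ℕ.pred s) λ i j → M k (skip l i) (ℤ.suc (column a′ Ĩ₀ j))) (size≡n k)))))
      where
      -- A cofactor reduces only for a size in successor form, so the size is made a variable before
      -- matching.
      general : ∀ n (N : Matrix n) → (∀ i j → N i j ≈ M k (toℕ i) (+ toℕ j)) → (l< : l ℕ.< n) →
        cofactor N (fromℕ< l<) ≈ sgn l * detℕ (ℕ.pred n) λ i j → M k (skip l i) (ℤ.suc (column a′ Ĩ₀ j))
      general (suc n) N N≈ l< = *-cong (reflexive (≡.cong sgn (Fin.toℕ-fromℕ< l<))) (det-cong {n} λ i j → trans
        (N≈ (punchIn (fromℕ< l<) i) (suc j)) (reflexive (≡.cong₂ (M k)
          (≡.trans (toℕ-punchIn (fromℕ< l<) i) (≡.cong (λ l → skip l (toℕ i)) (Fin.toℕ-fromℕ< l<)))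
          (≡.cong ℤ.suc (≡.sym (column-range 0 a′ (toℕ j)))))))

-- The matrices 1 - A⁺ and 1 - A⁻

<⇔0<- : ∀ m k → does (2 ℕ.* m ℕ.<? k) ≡ does (0ℤ ℤ.<? + k ℤ.- (+ m ℤ.+ + m))
<⇔0<- m k = does-⇔ (mk⇔ to from) (2 ℕ.* m ℕ.<? k) (0ℤ ℤ.<? + k ℤ.- + (m ℕ.+ m))
  where
  2*m≡m+m : 2 ℕ.* m ≡ m ℕ.+ m
  2*m≡m+m = ≡.cong (m ℕ.+_) (ℕ.+-identityʳ m)
  to : 2 ℕ.* m ℕ.< k → 0ℤ ℤ.< + k ℤ.- + (m ℕ.+ m)
  to 2m<k = ≡.subst (ℤ._< + k ℤ.- + (m ℕ.+ m)) (ℤ.+-inverseʳ (+ (m ℕ.+ m)))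
    (ℤ.+-monoˡ-< (ℤ.- + (m ℕ.+ m)) (ℤ.+<+ (≡.subst (ℕ._< k) 2*m≡m+m 2m<k)))
  from : 0ℤ ℤ.< + k ℤ.- + (m ℕ.+ m) → 2 ℕ.* m ℕ.< k
  from 0<k-2m = ≡.subst (ℕ._< k) (≡.sym 2*m≡m+m) (ℤ.drop‿+<+ (≡.subst₂ ℤ._<_
    (ℤ.+-identityʳ (+ (m ℕ.+ m))) (m+[x-m]≡x (+ (m ℕ.+ m)) (+ k)) (ℤ.+-monoʳ-< (+ (m ℕ.+ m)) 0<k-2m)))

-- All columns of `A⁻` lie strictly left of k/2, so the condition built into `E` always holds there
-- and the Hankel entry is present throughout.
<⌈/2⌉⇒2*< : ∀ m k → m ℕ.< ⌈ k /2⌉ → 2 ℕ.* m ℕ.< k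
<⌈/2⌉⇒2*< zero    (suc k)       _        = s≤s z≤n
<⌈/2⌉⇒2*< (suc m) (suc zero)    (s≤s ())
<⌈/2⌉⇒2*< (suc m) (suc (suc k)) (s≤s m<) =
  ≡.subst (ℕ._< 2 ℕ.+ k) (≡.sym (ℕ.*-suc 2 m)) (s≤s (s≤s (<⌈/2⌉⇒2*< m k m<)))

-- The conclusion is stated for a variable K, so that raw (commutativeRing 𝕂)
-- can be replaced with rawRing 𝕂 by matching on refl.
Rational : (K : RawRing c ℓ) (a b : ℤ) (ω : ℤ → RawRing.Carrier K) → Set (c ⊔ ℓ)
Rational K a b ω =
  (∃[ N⁺ ] IsPolynomial N⁺ × IsQuotient K⟦z⟧ F⁺ N⁺ (D K⟦z⟧ ι₁ (z₁ ·₁ z₁))) ×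
  (∃[ N⁻ ] IsPolynomial N⁻ × IsQuotient K⟦z⟧ F⁻ N⁻ (D K⟦z⟧ ι₁ (z₁ ·₁ z₁))) ×
  (∃[ Ñ⁺ ] IsPolynomial₂ Ñ⁺ ×
    IsQuotient K⟦u,z⟧ F⁺₂ Ñ⁺
      (D̃ K⟦u,z⟧ ι₂ (u₂ ·₂ (z₂ ·₂ z₂)) ·₂ D K⟦u,z⟧ ι₂ (z₂ ·₂ z₂))) ×
  (∃[ Ñ⁻ ] IsPolynomial₂ Ñ⁻ ×
    IsQuotient K⟦u,z⟧ F⁻₂ Ñ⁻
      (D̃ K⟦u,z⟧ ι₂ (u₂ ·₂ (z₂ ·₂ z₂)) ·₂ D K⟦u,z⟧ ι₂ (z₂ ·₂ z₂)))
  where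
  open PowerSeries K
  open Weighted K a b ω

module _ (R : CommutativeRing c ℓ) (a′ : ℕ)
  (ω : ℤ → CommutativeRing.Carrier R) (banded : IsBanded R (+ suc a′) ω) where

  open CommutativeRing R hiding (rawRing; zero)
  open Algebra.Properties.Ring ring
  open Determinant R
  open PowerSeries (raw R)
  open Weighted (raw R) (+ suc a′) (+ suc a′) ω

  -- σ is negation for A⁺ and the identity for A⁻.
  module Hankel (σ : Carrier → Carrier) (σ-0 : ∀ {x} → x ≈ 0# → σ x ≈ 0#) where
    E : ℤ → ℤ → Carrier
    E x y = if does (0ℤ ℤ.<? x) then σ (ω y) else 0#

    corner : IsCorner R (+ suc a′) E
    corner = record
      { E-≤ = λ {x} y x≤0 → reflexive (≡.cong (λ b → if b then σ (ω y) else 0#) (dec-false (0ℤ ℤ.<? x) (ℤ.≤⇒≯ x≤0)))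
      ; E-> = λ x a<y → truncated x (σ-0 (IsBanded.ω-> banded a<y))
      }
      where
      truncated : ∀ x {y} → σ (ω y) ≈ 0# → E x y ≈ 0#
      truncated x σω≈0 with does (0ℤ ℤ.<? x)
      ... | true  = σω≈0
      ... | false = refl

  module H⁺ = Hankel -_ (λ x≈0 → trans (-‿cong x≈0) -0#≈0#)
  module H⁻ = Hankel (λ x → x) (λ x≈0 → x≈0)
  module S⁺ = Recurrences R a′ ω banded H⁺.E H⁺.corner 1 1 (s≤s z≤n) (s≤s z≤n)
  module S⁻ = Recurrences R a′ ω banded H⁻.E H⁻.corner 0 1 z≤n (s≤s z≤n)
  module G⁺ = Generating R a′ ω banded H⁺.E H⁺.corner 1 1 (s≤s z≤n) (s≤s z≤n)
  module G⁻ = Generating R a′ ω banded H⁻.E H⁻.corner 0 1 z≤n (s≤s z≤n)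

  size⁺ : ∀ k → S⁺.size k ≡ suc ⌊ k /2⌋
  size⁺ 0             = ≡.refl
  size⁺ 1             = ≡.refl
  size⁺ (suc (suc k)) = ≡.cong suc (size⁺ k)

  size⁻ : ∀ k → S⁻.size k ≡ ⌈ k /2⌉
  size⁻ 0             = ≡.refl
  size⁻ 1             = ≡.refl
  size⁻ (suc (suc k)) = ≡.cong suc (size⁻ k)

  𝟙≈δ : ∀ {n} (i j : Fin n) → 𝟙 i j ≈ (if does (+ toℕ j ℤ.- + toℕ i ℤ.≟ 0ℤ) then 1# else 0#)
  𝟙≈δ i j = reflexive (≡.cong (λ b → if b then 1# else 0#)
    (does-⇔ (mk⇔ (λ { ≡.refl → ℤ.+-inverseʳ (+ toℕ i) })
                 (λ eq → Fin.toℕ-injective (ℤ.+-injective (≡.sym (ℤ.i-j≡0⇒i≡j _ _ eq)))))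
      (i Fin.≟ j) (+ toℕ j ℤ.- + toℕ i ℤ.≟ 0ℤ)))

  entry⁺ : ∀ k i j → (𝟙 ∸ A⁺ k) i j ≈ S⁺.M k (toℕ i) (+ toℕ j)
  entry⁺ k i j = trans (+-cong (𝟙≈δ i j) (hankel (<⇔0<- (toℕ j) k))) (sym (+-assoc _ _ _))
    where
    x = ω[ toℕ j - toℕ i ]
    y = ω[ k - toℕ j ℕ.+ toℕ i ]
    hankel : ∀ {b b′} → b ≡ b′ → - (if b then x + y else x) ≈ - x + (if b′ then - y else 0#)
    hankel {true}  ≡.refl = sym (-‿+-comm x y)
    hankel {false} ≡.refl = sym (+-identityʳ (- x))

  entry⁻ : ∀ k i j → (𝟙 ∸ A⁻ k) i j ≈ S⁻.M k (toℕ i) (+ toℕ j)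
  entry⁻ k i j = trans (+-cong (𝟙≈δ i j) hankel) (sym (+-assoc _ _ _))
    where
    x = ω[ toℕ j - toℕ i ]
    y = ω[ k - toℕ j ℕ.+ toℕ i ]
    left : true ≡ does (0ℤ ℤ.<? + k ℤ.- (+ toℕ j ℤ.+ + toℕ j))
    left = ≡.trans (≡.sym (dec-true (2 ℕ.* toℕ j ℕ.<? k) (<⌈/2⌉⇒2*< (toℕ j) k (Fin.toℕ<n j)))) (<⇔0<- (toℕ j) k)
    hankel : - (x + - y) ≈ - x + H⁻.E (+ k ℤ.- (+ toℕ j ℤ.+ + toℕ j)) (+ k ℤ.- (+ toℕ j ℤ.+ + toℕ i))
    hankel = trans (sym (-‿+-comm x (- y))) (+-congˡ (trans (-‿involutive y)
      (reflexive (≡.cong (λ b → if b then y else 0#) left))))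

  F⁺₂≈g : ∀ k l → F⁺₂ k l ≈ S⁺.g G⁺.Ĩ₀ k l
  F⁺₂≈g k l with l ℕ.<? suc ⌊ k /2⌋
  ... | yes l< = G⁺.cofactor≈g (λ k → suc ⌊ k /2⌋) size⁺ (λ k → 𝟙 ∸ A⁺ k) entry⁺ k l l<
  ... | no  l≮ = sym (S⁺.g-≥ G⁺.Ĩ₀ (≡.subst (ℕ._≤ l) (≡.sym (size⁺ k)) (ℕ.≮⇒≥ l≮)))

  F⁻₂≈g : ∀ k l → F⁻₂ k l ≈ S⁻.g G⁻.Ĩ₀ k l
  F⁻₂≈g k l with l ℕ.<? ⌈ k /2⌉
  ... | yes l< = G⁻.cofactor≈g (λ k → ⌈ k /2⌉) size⁻ (λ k → 𝟙 ∸ A⁻ k) entry⁻ k l l<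
  ... | no  l≮ = sym (S⁻.g-≥ G⁻.Ĩ₀ (≡.subst (ℕ._≤ l) (≡.sym (size⁻ k)) (ℕ.≮⇒≥ l≮)))

  rational : Rational (raw R) (+ suc a′) (+ suc a′) ω
  rational =
    G⁺.quotient₁ F⁺ refl (G⁺.det≈f (λ k → suc ⌊ k /2⌋) size⁺ (λ k → 𝟙 ∸ A⁺ k) entry⁺) ,
    G⁻.quotient₁ F⁻ refl (G⁻.det≈f (λ k → ⌈ k /2⌉) size⁻ (λ k → 𝟙 ∸ A⁻ k) entry⁻) ,
    G⁺.quotient₂ F⁺₂ F⁺₂≈g ,
    G⁻.quotient₂ F⁻₂ F⁻₂≈g

symmetric⇒b≡a : ∀ {S a b} → IsMax S a → IsMin S (ℤ.- b) → map ℤ.-_ S ≋ S → b ≡ a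
symmetric⇒b≡a {S} {a} {b} (a∈S , ≤a) (-b∈S , -b≤) (-S⊆S , _) = ℤ.≤-antisym
  (≤a (≡.subst (_∈ S) (ℤ.neg-involutive b) (-S⊆S (∈-map⁺ ℤ.-_ -b∈S))))
  (ℤ.neg-cancel-≤ (-b≤ (-S⊆S (∈-map⁺ ℤ.-_ a∈S))))

symmetric⇒rational : (R : CommutativeRing c ℓ) (K : RawRing c ℓ) → raw R ≡ K →
  (let open RawRing K using (_≈_; 0#)) →
  ∀ {S a b} → IsMax S a → 1ℤ ℤ.≤ a → IsMin S (ℤ.- b) → map ℤ.-_ S ≋ S →
  ∀ ω → (∀ s → s ∉ S → ω s ≈ 0#) → Rational K a b ω
symmetric⇒rational R _ ≡.refl {S} {+ suc a′} {b} a-max@(_ , ≤a) _ b-min@(_ , -b≤) -S≋S ω ω∉ =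
  ≡.subst (λ b → Rational (raw R) (+ suc a′) b ω) (≡.sym b≡a)
    (rational R a′ ω record
      { ω-> = λ a<s → ω∉ _ λ s∈S → ℤ.<⇒≱ a<s (≤a s∈S)
      ; ω-< = λ {s} s<-a → ω∉ _ λ s∈S → ℤ.<⇒≱ s<-a (≡.subst (λ b → ℤ.- b ℤ.≤ s) b≡a (-b≤ s∈S))
      })
  where
  b≡a : b ≡ + suc a′
  b≡a = symmetric⇒b≡a a-max b-min -S≋S
symmetric⇒rational R _ _ {a = + zero} _ (ℤ.+≤+ ())

mainTheorem13 :
    ∀ {c ℓ₁ ℓ₂} (𝕂 : HeytingField c ℓ₁ ℓ₂) →
    let open HeytingField 𝕂
        K = rawRing 𝕂
        open PowerSeries K
    in
    CharacteristicZero 𝕂 →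
    (S : List ℤ) (a b : ℤ) → IsMax S a → 1ℤ ℤ.≤ a → IsMin S (ℤ.- b) →
    (ω : ℤ → Carrier) → (∀ s → s ∉ S → ω s ≈ 0#) →
    IsSymmetric 𝕂 S ω →
    let open Weighted K a b ω in
    (∃[ N⁺ ] IsPolynomial N⁺ × IsQuotient K⟦z⟧ F⁺ N⁺ (D K⟦z⟧ ι₁ (z₁ ·₁ z₁))) ×
    (∃[ N⁻ ] IsPolynomial N⁻ × IsQuotient K⟦z⟧ F⁻ N⁻ (D K⟦z⟧ ι₁ (z₁ ·₁ z₁))) ×
    (∃[ Ñ⁺ ] IsPolynomial₂ Ñ⁺ ×
      IsQuotient K⟦u,z⟧ F⁺₂ Ñ⁺
        (D̃ K⟦u,z⟧ ι₂ (u₂ ·₂ (z₂ ·₂ z₂)) ·₂ D K⟦u,z⟧ ι₂ (z₂ ·₂ z₂))) ×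
    (∃[ Ñ⁻ ] IsPolynomial₂ Ñ⁻ ×
      IsQuotient K⟦u,z⟧ F⁻₂ Ñ⁻
        (D̃ K⟦u,z⟧ ι₂ (u₂ ·₂ (z₂ ·₂ z₂)) ·₂ D K⟦u,z⟧ ι₂ (z₂ ·₂ z₂)))
mainTheorem13 𝕂 _ S a b a-max 1≤a b-min ω ω∉ (-S≋S , _) =
  symmetric⇒rational (commutativeRing 𝕂) (rawRing 𝕂) ≡.refl a-max 1≤a b-min -S≋S ω ω∉
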